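{- For a permutation $\pi$ of $[n]$ let $G_\pi$ be its grid graph (defined in the context), let $\mathrm{Av}_n(213)$ be the set of $213$-avoiding permutations of $[n]$, and let $Q_4(n)=\sum_{\pi\in\mathrm{Av}_n(213)}\#\{v\in V(G_\pi):\deg(v)=4\}$. Then for all $n\ge 2$, \[ Q_4(n)=\frac{4n^3-7n^2+29n-20}{4(n+1)(2n-1)}\binom{2n}{n}-7\cdot 4^{\,n-2}. \]
   Context: The grid graph $G_\pi$ of a permutation $\pi=\pi_1\cdots\pi_n$ of $[n]$ has vertex set $\{(i,j):1\le i\le n,\ 1\le j\le \pi_i\}$; two vertices $(i,j),(i',j')$ are adjacent iff either $i=i'$ and $|j-j'|=1$, or $|i-i'|=1$ and $j=j'$. A permutation avoids $213$ if there are no indices $p<q<r$ with $\pi_q<\pi_p<\pi_r$. -}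

module Defs where

open import Data.Nat using (ℕ; zero; suc; _+_; _≤_; _<_; _≤?_; _<?_)
import Data.Nat as ℕ
open import Data.Fin using (Fin; toℕ)
import Data.Fin as F
open import Data.Fin.Properties using (all?)
open import Data.Vec using (Vec; []; _∷_; lookup)
open import Data.List using (List; []; _∷_; map; concatMap; upTo; filter; length; allFin)
open import Data.Nat.ListAction using (sum)
open import Data.Product using (_×_; _,_; Σ)
open import Data.Sum using (_⊎_)
open import Relation.Nullary using (¬_; Dec)
open import Relation.Nullary.Decidable using (_×-dec_; _⊎-dec_; _→-dec_; ¬?)
open import Relation.Binary.PropositionalEquality using (_≡_)

-- A permutation π = π₁⋯πₙ of [n] is represented by the vector (π₁,…,πₙ) : Vec ℕ n.
-- Positions are Fin n (position i : Fin n stands for index toℕ i + 1); values are in ℕ.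

words : (n m : ℕ) → List (Vec ℕ n)
words zero    m = [] ∷ []
words (suc n) m = concatMap (λ x → map (x ∷_) (words n m)) (map suc (upTo m))

IsPerm : {n : ℕ} → Vec ℕ n → Set
IsPerm {n} π = (∀ i → (1 ≤ lookup π i) × (lookup π i ≤ n))
             × (∀ i j → lookup π i ≡ lookup π j → i ≡ j)

isPerm? : {n : ℕ} → (π : Vec ℕ n) → Dec (IsPerm π)
isPerm? {n} π =
  all? (λ i → (1 ≤? lookup π i) ×-dec (lookup π i ≤? n))
  ×-dec all? (λ i → all? (λ j → (lookup π i ℕ.≟ lookup π j) →-dec (i F.≟ j)))

Avoids213 : {n : ℕ} → Vec ℕ n → Set
Avoids213 {n} π = ∀ (p q r : Fin n) → p F.< q → q F.< r →
  ¬ ((lookup π q < lookup π p) × (lookup π p < lookup π r))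

avoids213? : {n : ℕ} → (π : Vec ℕ n) → Dec (Avoids213 π)
avoids213? π =
  all? λ p → all? λ q → all? λ r →
    (p F.<? q) →-dec (q F.<? r) →-dec
      ¬? ((lookup π q <? lookup π p) ×-dec (lookup π p <? lookup π r))

Av213 : (n : ℕ) → List (Vec ℕ n)
Av213 n = filter avoids213? (filter isPerm? (words n n))

-- Grid graph G_π. A vertex (i , j) has column i : Fin n and height j : ℕ.
Vertex : ℕ → Set
Vertex n = Fin n × ℕ

vertices : {n : ℕ} → Vec ℕ n → List (Vertex n)
vertices {n} π = concatMap (λ i → map (λ j → (i , j)) (map suc (upTo (lookup π i)))) (allFin n)

Adj : {n : ℕ} → Vertex n → Vertex n → Set
Adj (i , j) (i' , j') =
  ((i ≡ i') × ((j ≡ suc j') ⊎ (j' ≡ suc j)))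
  ⊎ (((toℕ i ≡ suc (toℕ i')) ⊎ (toℕ i' ≡ suc (toℕ i))) × (j ≡ j'))

adj? : {n : ℕ} → (v w : Vertex n) → Dec (Adj v w)
adj? (i , j) (i' , j') =
  ((i F.≟ i') ×-dec ((j ℕ.≟ suc j') ⊎-dec (j' ℕ.≟ suc j)))
  ⊎-dec (((toℕ i ℕ.≟ suc (toℕ i')) ⊎-dec (toℕ i' ℕ.≟ suc (toℕ i))) ×-dec (j ℕ.≟ j'))

degree : {n : ℕ} → Vec ℕ n → Vertex n → ℕ
degree π v = length (filter (adj? v) (vertices π))

deg4count : {n : ℕ} → Vec ℕ n → ℕ
deg4count π = length (filter (λ v → degree π v ℕ.≟ 4) (vertices π))

Q4 : ℕ → ℕ
Q4 n = sum (map deg4count (Av213 n))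

{-# OPTIONS --safe #-}
module Submission where

-- A vertex of column i has degree 4 exactly when its height lies between 2 and
-- min(πᵢ₋₁, πᵢ − 1, πᵢ₊₁), so Q₄ is a sum over consecutive entries. A 213-avoiding permutation is
-- uniquely L′ 1 R′, where L′ and R′ are 213-avoiding L and R with values raised by |R| + 1 and by 1.
-- For the power series C (Catalan numbers), B = C + xC′, G (the sum of all min(πᵢ₋₁, πᵢ − 1, πᵢ₊₁))
-- and Q this gives linear equations with coefficients in ℤ[x, B, C], and C = 1 + xC² together with
-- (1 − 2xC)B = 1 solves them: 2G = xB′ − 2B² + 4B − 2BC + 4xB² + 2x²B² − xB + x and
-- Q = G − B + 4C − 2xC − 3. Here B has coefficients C(2n,n), and B² has coefficients 4ⁿ.

open import Defs
open import Algebra.Bundles using (CommutativeRing)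
open import Algebra.Solver.Ring.AlmostCommutativeRing
  using (_-Raw-AlmostCommutative⟶_; fromCommutativeRing)
import Algebra.Solver.Ring
open import Data.Fin using (Fin; zero; suc; toℕ)
import Data.Fin as F
import Data.Fin.Properties as FP
open import Data.List
  using (List; []; _∷_; map; length; _++_; upTo; concatMap; cartesianProductWith; filter; allFin; tabulate)
import Data.List.Properties as LP
open import Data.List.Membership.Propositional using (_∈_; find; lose)
open import Data.List.Membership.Propositional.Properties
open import Data.List.Membership.Propositional.Properties.WithK using (unique∧set⇒bag)
open import Data.List.Relation.Binary.BagAndSetEquality using (∼bag⇒↭)
open import Data.List.Relation.Binary.Permutation.Propositional using (_↭_)
open import Data.List.Relation.Binary.Permutation.Propositional.Properties using (↭-length; map⁺)
open import Data.List.Relation.Unary.All as All using (All; []; _∷_)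
import Data.List.Relation.Unary.All.Properties as AllP
open import Data.List.Relation.Unary.AllPairs as AP using (AllPairs; []; _∷_)
import Data.List.Relation.Unary.AllPairs.Properties as APP
open import Data.List.Relation.Unary.Any using (here; there; any?)
open import Data.List.Relation.Unary.Unique.Propositional using (Unique)
import Data.List.Relation.Unary.Unique.Propositional.Properties as UP
import Data.Maybe as Maybe
open import Data.Nat using (ℕ; zero; suc; pred; _∸_; _≤_; _<_; z≤n; s≤s; _!; NonZero)
import Data.Nat as ℕ
open import Data.Nat.ListAction using (sum)
open import Data.Nat.ListAction.Properties using (sum-++; sum-↭)
import Data.Nat.Properties as ℕP
import Data.Nat.Tactic.RingSolver as ℕRing
open import Data.Product using (_×_; _,_; proj₁; proj₂; ∃; ∃₂)
open import Data.Product.Properties using (,-injectiveˡ; ,-injectiveʳ)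
open import Data.Sum using (inj₁; inj₂)
open import Data.Unit using (⊤; tt)
open import Data.Vec as V using (Vec; []; _∷_; lookup; toList; fromList)
import Data.Vec.Properties as VP
open import Function using (_∘_; id; mk⇔)
open import Level using (0ℓ)
open import Relation.Binary using (tri<; tri≈; tri>)
open import Relation.Binary.PropositionalEquality
open import Relation.Nullary using (¬_; yes; no; contradiction)
open import Relation.Nullary.Decidable using (_×-dec_; decidable-stable; dec⇒maybe)
open import Relation.Unary using (Decidable)

-- The number of degree-4 vertices in a column is `pred` of a minimum, and `pred` truncates at 0, so
-- it does not commute with raising values. In `L′ 1 R′`, however, every value of both blocks has
-- been raised by at least 1. There the truncation disappears and each block contributes its
-- untruncated minima plus a term depending only on its size. Hence Q has no recursion in terms of
-- itself: it is an explicit expression in G, and only G satisfies a genuine recursion. Both are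
-- handled at once through a weight `φ` with `φ 0 = 0` and `φ (suc k + m) = φ (suc k) + m`, taken to
-- be `id` for G and `pred` for Q. The equation for G has the form (1 - 2xC) G = known terms, and B
-- inverts the factor 1 - 2xC. No square root of 1 - 4x has to be constructed: 1 - 2xC is one
-- already.

splitSum : (ℕ → ℕ → ℕ) → ℕ → ℕ
splitSum h zero    = h 0 0
splitSum h (suc n) = h 0 (suc n) ℕ.+ splitSum (h ∘ suc) n

splitSum-cong : ∀ {h k} → (∀ l r → h l r ≡ k l r) → ∀ n → splitSum h n ≡ splitSum k n
splitSum-cong p zero    = p 0 0
splitSum-cong p (suc n) = cong₂ ℕ._+_ (p 0 (suc n)) (splitSum-cong (p ∘ suc) n)

splitSum-+ : ∀ h k n → splitSum (λ l r → h l r ℕ.+ k l r) n ≡ splitSum h n ℕ.+ splitSum k n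
splitSum-+ h k zero    = refl
splitSum-+ h k (suc n) =
  trans (cong (ℕ._+_ (h 0 (suc n) ℕ.+ k 0 (suc n))) (splitSum-+ (h ∘ suc) (k ∘ suc) n))
        (lem (h 0 (suc n)) (k 0 (suc n)) _ _)
  where
  lem : ∀ a b c d → (a ℕ.+ b) ℕ.+ (c ℕ.+ d) ≡ (a ℕ.+ c) ℕ.+ (b ℕ.+ d)
  lem = ℕRing.solve-∀

-- Tells whether the last entry of a block has a left neighbour within the block. Only then does
-- that entry, once raised and placed in front of `1`, have a nonzero minimum, which is exactly 1.
ι : ℕ → ℕ
ι (suc (suc _)) = 1
ι _             = 0

module Counting where

  open import Data.Nat using (_+_; _*_; _⊓_; _≤?_)
  open ℕP

  -- Window sums

  head₀ : List ℕ → ℕ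
  head₀ []      = 0
  head₀ (x ∷ _) = x

  -- The sum of φ (min(a, b − 1, c)) over all entries b with left neighbour a and right neighbour c;
  -- p is the left neighbour of the first entry, and 0 stands for a missing neighbour.
  window : (ℕ → ℕ) → ℕ → List ℕ → ℕ
  window φ p []       = 0
  window φ p (x ∷ xs) = φ (p ⊓ (x ∸ 1) ⊓ head₀ xs) + window φ x xs

  Positive : List ℕ → Set
  Positive = All (1 ≤_)

  module Windows {φ : ℕ → ℕ} (φ-zero : φ 0 ≡ 0) (φ-shift : ∀ k m → φ (suc k + m) ≡ φ (suc k) + m) where

    open ≡-Reasoning

    φ-min-zero : ∀ m → φ (m ⊓ 0) ≡ 0
    φ-min-zero m = trans (cong φ (⊓-zeroʳ m)) φ-zero

    -- Minima commute with raising, so every entry but the last keeps its old minimum increased by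
    -- `suc k`. The last entry had no right neighbour, hence minimum 0, and now faces `1`. The entry
    -- `1` itself contributes `φ 0`, because `1 ∸ 1` is 0.
    window-lift-++ : ∀ k p xs ys → Positive xs →
      window φ (suc k + p) (map (suc k +_) xs ++ 1 ∷ ys)
        ≡ window id p xs + (φ (suc k) * (length xs ∸ 1) + φ 1 * ι (suc (length xs))) + window φ 1 ys
    window-lift-++ k p [] ys [] = begin
      φ ((suc k + p) ⊓ 0 ⊓ head₀ ys) + window φ 1 ys
        ≡⟨ cong (_+ window φ 1 ys) (cong (λ t → φ (t ⊓ head₀ ys)) (⊓-zeroʳ (suc k + p))) ⟩
      φ 0 + window φ 1 ys
        ≡⟨ cong (_+ window φ 1 ys) φ-zero ⟩
      window φ 1 ys
        ≡⟨ cong (_+ window φ 1 ys) (cong₂ _+_ (*-zeroʳ (φ (suc k))) (*-zeroʳ (φ 1))) ⟨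
      φ (suc k) * 0 + φ 1 * 0 + window φ 1 ys ∎
    window-lift-++ k p (suc x ∷ []) ys (_ ∷ []) = begin
      φ ((suc k + p) ⊓ (k + suc x) ⊓ 1) + window φ (suc k + suc x) (1 ∷ ys)
        ≡⟨ cong₂ _+_
             (cong φ (trans (cong (λ t → suc (k + p) ⊓ t ⊓ 1) (+-suc k x)) (cong suc (⊓-zeroʳ ((k + p) ⊓ (k + x))))))
             (window-lift-++ k (suc x) [] ys []) ⟩
      φ 1 + (φ (suc k) * 0 + φ 1 * 0 + window φ 1 ys)
        ≡⟨ lem (φ (suc k)) (φ 1) (window φ 1 ys) ⟩
      φ (suc k) * 0 + φ 1 * 1 + window φ 1 ys
        ≡⟨ cong (λ t → t + 0 + (φ (suc k) * 0 + φ 1 * 1) + window φ 1 ys) (⊓-zeroʳ (p ⊓ x)) ⟨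
      (p ⊓ x ⊓ 0 + 0) + (φ (suc k) * 0 + φ 1 * 1) + window φ 1 ys ∎
      where
      lem : ∀ a b w → b + (a * 0 + b * 0 + w) ≡ a * 0 + b * 1 + w
      lem = ℕRing.solve-∀
    window-lift-++ k p (x ∷ xs@(y ∷ zs)) ys (1≤x ∷ pos) = begin
      φ ((suc k + p) ⊓ (suc k + x ∸ 1) ⊓ (suc k + y)) + window φ (suc k + x) (map (suc k +_) xs ++ 1 ∷ ys)
        ≡⟨ cong₂ _+_ first (window-lift-++ k x xs ys pos) ⟩
      (φ (suc k) + p ⊓ (x ∸ 1) ⊓ y)
        + (window id x xs + (φ (suc k) * length zs + φ 1 * 1) + window φ 1 ys)
        ≡⟨ lem (φ (suc k)) (φ 1) (p ⊓ (x ∸ 1) ⊓ y) (window id x xs) (length zs) (window φ 1 ys) ⟩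
      (p ⊓ (x ∸ 1) ⊓ y + window id x xs) + (φ (suc k) * suc (length zs) + φ 1 * 1) + window φ 1 ys ∎
      where
      first : φ ((suc k + p) ⊓ (suc k + x ∸ 1) ⊓ (suc k + y)) ≡ φ (suc k) + p ⊓ (x ∸ 1) ⊓ y
      first = begin
        φ ((suc k + p) ⊓ (suc k + x ∸ 1) ⊓ (suc k + y))
          ≡⟨ cong (λ t → φ ((suc k + p) ⊓ t ⊓ (suc k + y))) (+-∸-assoc (suc k) 1≤x) ⟩
        φ ((suc k + p) ⊓ (suc k + (x ∸ 1)) ⊓ (suc k + y))
          ≡⟨ cong (λ t → φ (t ⊓ (suc k + y))) (+-distribˡ-⊓ (suc k) p (x ∸ 1)) ⟨
        φ ((suc k + p ⊓ (x ∸ 1)) ⊓ (suc k + y))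
          ≡⟨ cong φ (+-distribˡ-⊓ (suc k) (p ⊓ (x ∸ 1)) y) ⟨
        φ (suc k + p ⊓ (x ∸ 1) ⊓ y)
          ≡⟨ φ-shift k _ ⟩
        φ (suc k) + p ⊓ (x ∸ 1) ⊓ y ∎
      lem : ∀ a b m w l v → (a + m) + (w + (a * l + b * 1) + v) ≡ (m + w) + (a * (1 + l) + b * 1) + v
      lem = ℕRing.solve-∀

    -- The left neighbour is raised together with the entries. For `p = 0` the entry `1` in front of
    -- the right block thus serves as the raised image of a missing neighbour. The last entry
    -- contributes 0 on both sides, whence `length xs ∸ 1`.
    window-suc : ∀ p xs → Positive xs →
      window φ (suc p) (map suc xs) ≡ window id p xs + φ 1 * (length xs ∸ 1)
    window-suc p [] [] = sym (*-zeroʳ (φ 1))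
    window-suc p (x ∷ []) _ = begin
      φ (suc p ⊓ x ⊓ 0) + 0            ≡⟨ cong (_+ 0) (φ-min-zero (suc p ⊓ x)) ⟩
      0                                ≡⟨ *-zeroʳ (φ 1) ⟨
      φ 1 * 0                          ≡⟨ cong (λ t → t + 0 + φ 1 * 0) (⊓-zeroʳ (p ⊓ (x ∸ 1))) ⟨
      p ⊓ (x ∸ 1) ⊓ 0 + 0 + φ 1 * 0    ∎
    window-suc p (suc x ∷ xs@(y ∷ zs)) (_ ∷ pos) = begin
      φ (suc (p ⊓ x ⊓ y)) + window φ (suc (suc x)) (map suc xs)
        ≡⟨ cong₂ _+_ (φ-shift 0 (p ⊓ x ⊓ y)) (window-suc (suc x) xs pos) ⟩
      (φ 1 + p ⊓ x ⊓ y) + (window id (suc x) xs + φ 1 * length zs)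
        ≡⟨ lem (φ 1) (p ⊓ x ⊓ y) (window id (suc x) xs) (length zs) ⟩
      (p ⊓ x ⊓ y + window id (suc x) xs) + φ 1 * suc (length zs) ∎
      where
      lem : ∀ a m w l → (a + m) + (w + a * l) ≡ (m + w) + a * (1 + l)
      lem = ℕRing.solve-∀

    -- The first entry of the left block still lacks a left neighbour, so only the interior entries
    -- gain `φ (suc k)`. Truncated subtraction and `ι` take care of blocks with fewer than two
    -- entries.
    window-join : ∀ k xs ys → Positive xs → Positive ys →
      window φ 0 (map (suc k +_) xs ++ 1 ∷ map suc ys)
        ≡ window id 0 xs + window id 0 ys
          + (φ (suc k) * (length xs ∸ 2) + φ 1 * (ι (length xs) + (length ys ∸ 1)))
    window-join k [] ys _ pos = begin
      φ 0 + window φ 1 (map suc ys)    ≡⟨ cong₂ _+_ φ-zero (window-suc 0 ys pos) ⟩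
      window id 0 ys + φ 1 * (length ys ∸ 1)
        ≡⟨ cong (λ t → window id 0 ys + (t + φ 1 * (length ys ∸ 1))) (*-zeroʳ (φ (suc k))) ⟨
      window id 0 ys + (φ (suc k) * 0 + φ 1 * (length ys ∸ 1)) ∎
    window-join k (x ∷ xs) ys (_ ∷ posx) pos = begin
      φ 0 + window φ (suc k + x) (map (suc k +_) xs ++ 1 ∷ map suc ys)
        ≡⟨ cong₂ _+_ φ-zero (window-lift-++ k x xs (map suc ys) posx) ⟩
      window id x xs + (φ (suc k) * (length xs ∸ 1) + φ 1 * i) + window φ 1 (map suc ys)
        ≡⟨ cong (window id x xs + (φ (suc k) * (length xs ∸ 1) + φ 1 * i) +_) (window-suc 0 ys pos) ⟩
      window id x xs + (φ (suc k) * (length xs ∸ 1) + φ 1 * i) + (window id 0 ys + φ 1 * (length ys ∸ 1))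
        ≡⟨ lem (window id x xs) (window id 0 ys) (φ (suc k)) (φ 1) (length xs ∸ 1) i (length ys ∸ 1) ⟩
      window id x xs + window id 0 ys + (φ (suc k) * (length xs ∸ 1) + φ 1 * (i + (length ys ∸ 1))) ∎
      where
      i = ι (suc (length xs))
      lem : ∀ u v a b l i r → u + (a * l + b * i) + (v + b * r) ≡ u + v + (a * l + b * (i + r))
      lem = ℕRing.solve-∀

  -- Lists indexed by the splittings of n

  splitList : {A : Set} → (ℕ → ℕ → List A) → ℕ → List A
  splitList h zero    = h 0 0
  splitList h (suc n) = h 0 (suc n) ++ splitList (h ∘ suc) n

  module _ {A : Set} where

    length-splitList : (h : ℕ → ℕ → List A) → ∀ n →
      length (splitList h n) ≡ splitSum (λ l r → length (h l r)) n
    length-splitList h zero    = refl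
    length-splitList h (suc n) = trans (LP.length-++ (h 0 (suc n)))
      (cong (length (h 0 (suc n)) +_) (length-splitList (h ∘ suc) n))

    sum-map-splitList : (f : A → ℕ) (h : ℕ → ℕ → List A) → ∀ n →
      sum (map f (splitList h n)) ≡ splitSum (λ l r → sum (map f (h l r))) n
    sum-map-splitList f h zero    = refl
    sum-map-splitList f h (suc n) = trans (cong sum (LP.map-++ f (h 0 (suc n)) _))
      (trans (sum-++ (map f (h 0 (suc n))) _)
        (cong (sum (map f (h 0 (suc n))) +_) (sum-map-splitList f (h ∘ suc) n)))

    ∈-splitList⁺ : ∀ h l r {x : A} → x ∈ h l r → x ∈ splitList h (l + r)
    ∈-splitList⁺ h zero    zero    p = p
    ∈-splitList⁺ h zero    (suc r) p = ∈-++⁺ˡ p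
    ∈-splitList⁺ h (suc l) r       p = ∈-++⁺ʳ (h 0 (suc (l + r))) (∈-splitList⁺ (h ∘ suc) l r p)

    ∈-splitList⁻ : ∀ h n {x : A} → x ∈ splitList h n → ∃₂ λ l r → l + r ≡ n × x ∈ h l r
    ∈-splitList⁻ h zero    p = 0 , 0 , refl , p
    ∈-splitList⁻ h (suc n) p with ∈-++⁻ (h 0 (suc n)) p
    ... | inj₁ q = 0 , suc n , refl , q
    ... | inj₂ q with l , r , e , q′ ← ∈-splitList⁻ (h ∘ suc) n q = suc l , r , cong suc e , q′

    -- An element determines its left size through `key`, so the parts for different splittings are
    -- disjoint.
    splitList-unique : ∀ h (key : A → ℕ) → (∀ l r → Unique (h l r)) →
      (∀ l r {x} → x ∈ h l r → key x ≡ l) → ∀ n → Unique (splitList h n)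
    splitList-unique h key u k zero    = u 0 0
    splitList-unique h key u k (suc n) = UP.++⁺ (u 0 (suc n))
      (splitList-unique (h ∘ suc) (pred ∘ key) (u ∘ suc) (λ l r p → cong pred (k (suc l) r p)) n)
      λ (p , q) → let l , r , _ , q′ = ∈-splitList⁻ (h ∘ suc) n q in
        0≢1+n (trans (sym (k 0 (suc n) p)) (k (suc l) r q′))

  module _ {A B C : Set} (f : A → B → C) where

    length-cartesianProductWith : ∀ xs ys →
      length (cartesianProductWith f xs ys) ≡ length xs * length ys
    length-cartesianProductWith []       ys = refl
    length-cartesianProductWith (x ∷ xs) ys = trans (LP.length-++ (map (f x) ys))
      (cong₂ _+_ (LP.length-map (f x) ys) (length-cartesianProductWith xs ys))

    sum-cartesianProductWith : (h : C → ℕ) (a : A → ℕ) (b : B → ℕ) (k : ℕ) → ∀ xs ys →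
      (∀ {x y} → x ∈ xs → y ∈ ys → h (f x y) ≡ a x + b y + k) →
      sum (map h (cartesianProductWith f xs ys))
        ≡ sum (map a xs) * length ys + length xs * sum (map b ys) + length xs * length ys * k
    sum-cartesianProductWith h a b k []       ys e = refl
    sum-cartesianProductWith h a b k (x ∷ xs) ys e = begin
      sum (map h (map (f x) ys ++ cartesianProductWith f xs ys))
        ≡⟨ cong sum (LP.map-++ h (map (f x) ys) _) ⟩
      sum (map h (map (f x) ys) ++ map h (cartesianProductWith f xs ys))
        ≡⟨ sum-++ (map h (map (f x) ys)) _ ⟩
      sum (map h (map (f x) ys)) + sum (map h (cartesianProductWith f xs ys))
        ≡⟨ cong₂ _+_ (row ys (e (here refl))) (sum-cartesianProductWith h a b k xs ys (e ∘ there)) ⟩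
      (a x * n + β + n * k) + (α * n + m * β + m * n * k)
        ≡⟨ lem (a x) n β k α m ⟩
      (a x + α) * n + suc m * β + suc m * n * k ∎
      where
      open ≡-Reasoning
      n = length ys
      m = length xs
      α = sum (map a xs)
      β = sum (map b ys)
      lem : ∀ c n β k α m → (c * n + β + n * k) + (α * n + m * β + m * n * k)
        ≡ (c + α) * n + (1 + m) * β + (1 + m) * n * k
      lem = ℕRing.solve-∀
      row : ∀ ys → (∀ {y} → y ∈ ys → h (f x y) ≡ a x + b y + k) →
        sum (map h (map (f x) ys)) ≡ a x * length ys + sum (map b ys) + length ys * k
      row [] e = sym (cong (λ t → t + 0 + 0) (*-zeroʳ (a x)))
      row (y ∷ ys) e = trans (cong₂ _+_ (e (here refl)) (row ys (e ∘ there)))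
        (lem′ (a x) (b y) k (length ys) (sum (map b ys)))
        where
        lem′ : ∀ c d k n β → (c + d + k) + (c * n + β + n * k) ≡ c * (1 + n) + (d + β) + (1 + n) * k
        lem′ = ℕRing.solve-∀

  -- Permutations avoiding 213, as lists

  module _ {A : Set} where

    AllPairs-++⁻ : ∀ {R : A → A → Set} xs {ys} → AllPairs R (xs ++ ys) →
      AllPairs R xs × AllPairs R ys × All (λ x → All (R x) ys) xs
    AllPairs-++⁻ []       p       = [] , p , []
    AllPairs-++⁻ (x ∷ xs) (q ∷ p) with a , b , c ← AllPairs-++⁻ xs p =
      AllP.++⁻ˡ xs q ∷ a , b , AllP.++⁻ʳ xs q ∷ c

    -- The pigeonhole principle. The value ranges of the two blocks and the degree counts in the
    -- grid graph both rest on it.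
    unique-⊆⇒length≤ : {xs ys : List A} → Unique xs → (∀ {x} → x ∈ xs → x ∈ ys) → length xs ≤ length ys
    unique-⊆⇒length≤ {[]}     _       _   = z≤n
    unique-⊆⇒length≤ {x ∷ xs} (n ∷ u) sub with ys₁ , ys₂ , refl ← ∈-∃++ (sub (here refl)) =
      ≤-trans (s≤s (unique-⊆⇒length≤ u sub′)) (≤-reflexive (begin
        suc (length (ys₁ ++ ys₂))          ≡⟨ cong suc (LP.length-++ ys₁) ⟩
        suc (length ys₁ + length ys₂)      ≡⟨ +-suc (length ys₁) (length ys₂) ⟨
        length ys₁ + suc (length ys₂)      ≡⟨ LP.length-++ ys₁ ⟨
        length (ys₁ ++ x ∷ ys₂)            ∎))
      where
      open ≡-Reasoning
      sub′ : ∀ {y} → y ∈ xs → y ∈ ys₁ ++ ys₂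
      sub′ y∈xs with ∈-++⁻ ys₁ (sub (there y∈xs))
      ... | inj₁ p           = ∈-++⁺ˡ p
      ... | inj₂ (here refl) = contradiction refl (All.lookup n y∈xs)
      ... | inj₂ (there p)   = ∈-++⁺ʳ ys₁ p

  length-upTo : ∀ n → length (upTo n) ≡ n
  length-upTo = LP.length-applyUpTo id

  unique-range⇒length≤ : ∀ {xs} a k → Unique xs → All (λ x → a ≤ x × x < a + k) xs → length xs ≤ k
  unique-range⇒length≤ {xs} a k u p = ≤-trans (unique-⊆⇒length≤ u sub)
    (≤-reflexive (trans (LP.length-map (a +_) (upTo k)) (length-upTo k)))
    where
    sub : ∀ {x} → x ∈ xs → x ∈ map (a +_) (upTo k)
    sub {x} x∈xs with a≤x , x<a+k ← All.lookup p x∈xs =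
      subst (_∈ map (a +_) (upTo k)) (m+[n∸m]≡n a≤x)
        (∈-map⁺ (a +_) (∈-upTo⁺ (+-cancelˡ-< a _ _ (subst (_< a + k) (sym (m+[n∸m]≡n a≤x)) x<a+k))))

  NoAscentOver : ℕ → ℕ → ℕ → Set
  NoAscentOver x y z = ¬ (y < x × x < z)

  -- The head plays the `2` of the pattern and an ordered pair behind it the `1` and the `3`. The
  -- recursive form fits the splitting of a list at an entry.
  Avoiding : List ℕ → Set
  Avoiding []       = ⊤
  Avoiding (x ∷ xs) = AllPairs (NoAscentOver x) xs × Avoiding xs

  record Valid (n : ℕ) (xs : List ℕ) : Set where
    constructor valid
    field
      size     : length xs ≡ n
      range    : All (λ x → 1 ≤ x × x ≤ n) xs
      unique   : Unique xs
      avoiding : Avoiding xs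

  avoiding-++⁻ : ∀ xs {ys} → Avoiding (xs ++ ys) →
    Avoiding xs × Avoiding ys × All (λ x → AllPairs (NoAscentOver x) ys) xs
  avoiding-++⁻ []       p       = tt , p , []
  avoiding-++⁻ (x ∷ xs) (q , p)
    with a , b , c ← avoiding-++⁻ xs p | q₁ , q₂ , _ ← AllPairs-++⁻ xs q = (q₁ , a) , b , q₂ ∷ c

  AllPairs-universal : {A : Set} {R : A → A → Set} → (∀ x y → R x y) → ∀ xs → AllPairs R xs
  AllPairs-universal r []       = []
  AllPairs-universal r (x ∷ xs) = All.universal (r x) xs ∷ AllPairs-universal r xs

  AllPairs-allʳ : {A : Set} {R : A → A → Set} {xs : List A} → All (λ y → ∀ x → R x y) xs → AllPairs R xs
  AllPairs-allʳ []       = []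
  AllPairs-allʳ (r ∷ rs) = All.map (λ f → f _) rs ∷ AllPairs-allʳ rs

  -- An occurrence of the pattern with its `2` in `xs` must have its `3` in `xs` too, since all of
  -- `ys` is smaller than that `2`; it then lies entirely in `xs`.
  avoiding-++⁺ : ∀ {xs ys} → Avoiding xs → Avoiding ys → All (λ x → All (_< x) ys) xs → Avoiding (xs ++ ys)
  avoiding-++⁺ {[]}     _       q _        = q
  avoiding-++⁺ {x ∷ xs} (p , P) q (a ∷ as) =
    APP.++⁺ p (AllPairs-allʳ (All.map (λ z<x _ → <⇒≱ z<x ∘ <⇒≤ ∘ proj₂) a))
      (All.universal (λ _ → All.map (λ z<x → <⇒≱ z<x ∘ <⇒≤ ∘ proj₂) a) xs)
    , avoiding-++⁺ P q as

  module _ {f : ℕ → ℕ} where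

    avoiding-map⁺ : (∀ {x y} → f x < f y → x < y) → ∀ {xs} → Avoiding xs → Avoiding (map f xs)
    avoiding-map⁺ c {[]}     _       = tt
    avoiding-map⁺ c {x ∷ xs} (p , q) =
      APP.map⁺ (AP.map (λ h (a , b) → h (c a , c b)) p) , avoiding-map⁺ c q

    avoiding-map⁻ : (∀ {x y} → x < y → f x < f y) → ∀ {xs} → Avoiding (map f xs) → Avoiding xs
    avoiding-map⁻ m {[]}     _       = tt
    avoiding-map⁻ m {x ∷ xs} (p , q) =
      AP.map (λ h (a , b) → h (m a , m b)) (APP.map⁻ p) , avoiding-map⁻ m q

  joinLists : ℕ → List ℕ → List ℕ → List ℕ
  joinLists r xs ys = map (suc r +_) xs ++ 1 ∷ map suc ys

  valid-join : ∀ {l r xs ys} → Valid l xs → Valid r ys → Valid (suc (l + r)) (joinLists r xs ys)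
  valid-join {l} {r} {xs} {ys} (valid refl ρ u a) (valid refl ρ′ u′ a′) = record
    { size = trans (LP.length-++ (map (suc r +_) xs))
        (trans (cong₂ (λ s t → s + suc t) (LP.length-map (suc r +_) xs) (LP.length-map suc ys)) (+-suc l r))
    ; range = AllP.++⁺
        (AllP.map⁺ (All.map (λ (_ , x≤l) → s≤s z≤n , s≤s (subst (_≤ l + r) (+-comm _ r) (+-monoˡ-≤ r x≤l))) ρ))
        ((s≤s z≤n , s≤s z≤n) ∷ AllP.map⁺ (All.map (λ (_ , y≤r) → s≤s z≤n , s≤s (≤-trans y≤r (m≤n+m r l))) ρ′))
    ; unique = APP.++⁺ (UP.map⁺ (+-cancelˡ-≡ (suc r) _ _) u)
        (AllP.map⁺ (All.map (λ (1≤y , _) e → <⇒≢ (s≤s 1≤y) e) ρ′) ∷ UP.map⁺ suc-injective u′)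
        (All.map (All.map λ y<x e → <⇒≢ y<x (sym e)) below)
    ; avoiding = avoiding-++⁺ (avoiding-map⁺ (+-cancelˡ-< (suc r) _ _) a)
        (APP.map⁺ (AllPairs-universal (λ { y z (s≤s () , _) }) ys) , avoiding-map⁺ (λ { (s≤s p) → p }) a′)
        below
    }
    where
    below : All (λ x → All (_< x) (1 ∷ map suc ys)) (map (suc r +_) xs)
    below = AllP.map⁺ (All.map (λ {x} (1≤x , _) →
      s≤s (≤-trans 1≤x (m≤n+m x r)) ∷
      AllP.map⁺ (All.map (λ (_ , y≤r) → s≤s (<-≤-trans (s≤s y≤r) (subst (_≤ r + x) (+-comm r 1) (+-monoʳ-≤ r 1≤x)))) ρ′)) ρ)

  All≥⇒map-+ : ∀ {k xs} → All (k ≤_) xs → ∃ λ ys → xs ≡ map (k +_) ys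
  All≥⇒map-+ []                  = [] , refl
  All≥⇒map-+ {k} {x ∷ _} (q ∷ p) with ys , e ← All≥⇒map-+ p =
    x ∸ k ∷ ys , cong₂ _∷_ (sym (m+[n∸m]≡n q)) e

  -- Standardisation of a block: its values are distinct and lie in an interval as long as the
  -- block, so subtracting `k` leaves a permutation.
  lower : ∀ k {xs} → All (λ x → k + 1 ≤ x × x ≤ k + length xs) xs → Unique xs → Avoiding xs →
    ∃ λ ys → xs ≡ map (k +_) ys × Valid (length xs) ys
  lower k {xs} p u a with ys , refl ← All≥⇒map-+ (All.map (λ (q , _) → m+n≤o⇒m≤o k q) p) =
    ys , refl , record
      { size     = sym (LP.length-map (k +_) ys)
      ; range    = All.map (λ (q , r) → +-cancelˡ-≤ k _ _ q , +-cancelˡ-≤ k _ _ r) (AllP.map⁻ p)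
      ; unique   = UP.map⁻ u
      ; avoiding = avoiding-map⁻ (+-monoʳ-< k) a
      }

  -- The entries before the value 1 exceed all entries after it, so counting forces both value ranges.
  split-at-1 : ∀ {n} xs ys → Valid (suc n) (xs ++ 1 ∷ ys) → length xs + length ys ≡ n ×
    ∃₂ λ xs′ ys′ → Valid (length xs) xs′ × Valid (length ys) ys′
      × xs ++ 1 ∷ ys ≡ joinLists (length ys) xs′ ys′
  split-at-1 {n} xs ys (valid size range unique avoiding) = sizes ,
    let xs′ , ex , vx = lower (suc r) (All.tabulate λ p → lower-x p , upper-x p) (proj₁ u) (proj₁ a)
        ys′ , ey , vy = lower 1 (All.tabulate λ p → 1<y p , upper-y p) (AP.tail (proj₁ (proj₂ u))) (proj₂ (proj₁ (proj₂ a)))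
    in xs′ , ys′ , vx , vy , cong₂ (λ s t → s ++ 1 ∷ t) ex ey
    where
    l = length xs
    r = length ys
    u = AllPairs-++⁻ xs unique
    a = avoiding-++⁻ xs avoiding

    sizes : l + r ≡ n
    sizes = suc-injective (trans (sym (+-suc l r)) (trans (sym (LP.length-++ xs)) size))

    1<x : ∀ {x} → x ∈ xs → 1 < x
    1<x p = ≤∧≢⇒< (proj₁ (All.lookup range (∈-++⁺ˡ p))) (All.head (All.lookup (proj₂ (proj₂ u)) p) ∘ sym)

    1<y : ∀ {y} → y ∈ ys → 1 < y
    1<y p = ≤∧≢⇒< (proj₁ (All.lookup range (∈-++⁺ʳ xs (there p)))) (All.lookup (AP.head (proj₁ (proj₂ u))) p)

    y<x : ∀ {x y} → x ∈ xs → y ∈ ys → y < x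
    y<x p q = ≤∧≢⇒<
      -- Otherwise `x`, `1`, `y` would form the pattern 213.
      (≮⇒≥ λ x<y → All.lookup (AP.head (All.lookup (proj₂ (proj₂ a)) p)) q (1<x p , x<y))
      (All.lookup (All.tail (All.lookup (proj₂ (proj₂ u)) p)) q ∘ sym)

    -- The `r` entries after `1` lie among 2, ..., x - 1, so r ≤ x - 2. Dually, in `upper-y`, the
    -- `l` entries before `1` lie among y + 1, ..., n + 1.
    lower-x : ∀ {x} → x ∈ xs → suc r + 1 ≤ x
    lower-x {x} p = subst₂ _≤_ (cong suc (+-comm 1 r)) (m+[n∸m]≡n (1<x p)) (+-monoʳ-≤ 2
      (unique-range⇒length≤ 2 (x ∸ 2) (AP.tail (proj₁ (proj₂ u)))
        (All.tabulate λ q → 1<y q , <-≤-trans (y<x p q) (≤-reflexive (sym (m+[n∸m]≡n (1<x p)))))))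

    upper-x : ∀ {x} → x ∈ xs → x ≤ suc r + l
    upper-x p = ≤-trans (proj₂ (All.lookup range (∈-++⁺ˡ p)))
      (≤-reflexive (cong suc (trans (sym sizes) (+-comm l r))))

    upper-y : ∀ {y} → y ∈ ys → y ≤ 1 + r
    upper-y {y} q = +-cancelˡ-≤ l y (1 + r) (≤-trans (+-monoˡ-≤ y count)
      (≤-reflexive (trans (m∸n+n≡m y≤) (trans (cong suc (sym sizes)) (sym (+-suc l r))))))
      where
      y≤ : y ≤ suc n
      y≤ = proj₂ (All.lookup range (∈-++⁺ʳ xs (there q)))
      count : l ≤ suc n ∸ y
      count = unique-range⇒length≤ (suc y) (suc n ∸ y) (proj₁ u) (All.tabulate λ p →
        y<x p q , s≤s (≤-trans (proj₂ (All.lookup range (∈-++⁺ˡ p))) (≤-reflexive (sym (m+[n∸m]≡n y≤)))))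

  valid-split : ∀ {n zs} → Valid (suc n) zs → ∃₂ λ l r → l + r ≡ n ×
    ∃₂ λ xs ys → Valid l xs × Valid r ys × zs ≡ joinLists r xs ys
  valid-split {n} {zs} v@(valid size range unique _) with any? (1 ℕ.≟_) zs
  ... | yes 1∈zs with xs , ys , refl ← ∈-∃++ 1∈zs = length xs , length ys , split-at-1 xs ys v
  -- Without the value 1 there would be n + 1 distinct values among 2, ..., n + 1.
  ... | no 1∉zs = contradiction
    (≤-trans (≤-reflexive (sym size)) (unique-range⇒length≤ 2 n unique (All.tabulate λ p →
      let 1≤x , x≤ = All.lookup range p in ≤∧≢⇒< 1≤x (λ { refl → 1∉zs p }) , s≤s x≤)))
    (n≮n n)

  -- Passage between vectors and lists.

  module _ {A : Set} where

    All-toList⁺ : ∀ {n} {P : A → Set} (v : Vec A n) → (∀ i → P (lookup v i)) → All P (toList v)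
    All-toList⁺ []      p = []
    All-toList⁺ (x ∷ v) p = p zero ∷ All-toList⁺ v (p ∘ suc)

    All-toList⁻ : ∀ {n} {P : A → Set} (v : Vec A n) → All P (toList v) → ∀ i → P (lookup v i)
    All-toList⁻ (x ∷ v) (p ∷ _) zero    = p
    All-toList⁻ (x ∷ v) (_ ∷ p) (suc i) = All-toList⁻ v p i

    AllPairs-toList⁺ : ∀ {n} {R : A → A → Set} (v : Vec A n) →
      (∀ i j → i F.< j → R (lookup v i) (lookup v j)) → AllPairs R (toList v)
    AllPairs-toList⁺ []      p = []
    AllPairs-toList⁺ (x ∷ v) p =
      All-toList⁺ v (λ i → p zero (suc i) (s≤s z≤n)) ∷ AllPairs-toList⁺ v (λ i j → p (suc i) (suc j) ∘ s≤s)

    AllPairs-toList⁻ : ∀ {n} {R : A → A → Set} (v : Vec A n) →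
      AllPairs R (toList v) → ∀ i j → i F.< j → R (lookup v i) (lookup v j)
    AllPairs-toList⁻ (x ∷ v) (p ∷ _) zero    (suc j) _       = All-toList⁻ v p j
    AllPairs-toList⁻ (x ∷ v) (_ ∷ p) (suc i) (suc j) (s≤s q) = AllPairs-toList⁻ v p i j q

  avoids⇒avoiding : ∀ {n} (v : Vec ℕ n) → Avoids213 v → Avoiding (toList v)
  avoids⇒avoiding []      _ = tt
  avoids⇒avoiding (x ∷ v) p =
    AllPairs-toList⁺ v (λ q r q<r → p zero (suc q) (suc r) (s≤s z≤n) (s≤s q<r))
    , avoids⇒avoiding v (λ i q r i<q q<r → p (suc i) (suc q) (suc r) (s≤s i<q) (s≤s q<r))

  avoiding⇒avoids : ∀ {n} (v : Vec ℕ n) → Avoiding (toList v) → Avoids213 v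
  avoiding⇒avoids (x ∷ v) (p , _) zero    (suc q) (suc r) _         (s≤s q<r) = AllPairs-toList⁻ v p q r q<r
  avoiding⇒avoids (x ∷ v) (_ , p) (suc i) (suc q) (suc r) (s≤s i<q) (s≤s q<r) = avoiding⇒avoids v p i q r i<q q<r

  words-suc : ∀ n m → words (suc n) m ≡ cartesianProductWith _∷_ (map suc (upTo m)) (words n m)
  words-suc n m = go (map suc (upTo m))
    where
    go : ∀ xs → concatMap (λ x → map (x ∷_) (words n m)) xs ≡ cartesianProductWith _∷_ xs (words n m)
    go []       = refl
    go (x ∷ xs) = cong (map (x ∷_) (words n m) ++_) (go xs)

  words-unique : ∀ n m → Unique (words n m)
  words-unique zero    m = [] ∷ []
  words-unique (suc n) m = subst Unique (sym (words-suc n m))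
    (UP.cartesianProductWith⁺ _∷_ VP.∷-injective (UP.map⁺ suc-injective (UP.upTo⁺ m)) (words-unique n m))

  ∈-words : ∀ {n} m (v : Vec ℕ n) → (∀ i → 1 ≤ lookup v i × lookup v i ≤ m) → v ∈ words n m
  ∈-words m []      p = here refl
  ∈-words {suc n} m (x ∷ v) p = subst (x ∷ v ∈_) (sym (words-suc n m))
    (∈-cartesianProductWith⁺ _∷_ (x∈ (p zero)) (∈-words m v (p ∘ suc)))
    where
    x∈ : ∀ {x} → 1 ≤ x × x ≤ m → x ∈ map suc (upTo m)
    x∈ (s≤s _ , x≤m) = ∈-map⁺ suc (∈-upTo⁺ x≤m)

  Av213-unique : ∀ n → Unique (Av213 n)
  Av213-unique n = UP.filter⁺ avoids213? (UP.filter⁺ isPerm? (words-unique n n))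

  toList-injective : ∀ {n} {u v : Vec ℕ n} → toList u ≡ toList v → u ≡ v
  toList-injective {u = u} {v} e = trans (sym (VP.cast-is-id refl u)) (VP.toList-injective refl u v e)

  Av213⇒valid : ∀ {n v} → v ∈ Av213 n → Valid n (toList v)
  Av213⇒valid {n} {v} v∈ with v∈′ , av ← ∈-filter⁻ avoids213? {xs = filter isPerm? (words n n)} v∈
    with _ , range , inj ← ∈-filter⁻ isPerm? {xs = words n n} v∈′ = record
    { size     = VP.length-toList v
    ; range    = All-toList⁺ v range
    ; unique   = AllPairs-toList⁺ v (λ i j i<j e → FP.<⇒≢ i<j (inj i j e))
    ; avoiding = avoids⇒avoiding v av
    }

  valid⇒Av213 : ∀ {n xs} → Valid n xs → ∃ λ v → v ∈ Av213 n × xs ≡ toList v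
  valid⇒Av213 {n} {xs} w@(valid refl _ _ _) = v
    , ∈-filter⁺ avoids213? (∈-filter⁺ isPerm? (∈-words n v range) (range , inj))
        (avoiding⇒avoids v (Valid.avoiding w′))
    , sym e
    where
    v = fromList xs
    e : toList v ≡ xs
    e = VP.toList∘fromList xs
    w′ : Valid n (toList v)
    w′ = subst (Valid n) (sym e) w
    range : ∀ i → 1 ≤ lookup v i × lookup v i ≤ n
    range = All-toList⁻ v (Valid.range w′)
    inj : ∀ i j → lookup v i ≡ lookup v j → i ≡ j
    inj i j eq with FP.<-cmp i j
    ... | tri< i<j _ _ = contradiction eq (AllPairs-toList⁻ v (Valid.unique w′) i j i<j)
    ... | tri≈ _ i≡j _ = i≡j
    ... | tri> _ _ j<i = contradiction (sym eq) (AllPairs-toList⁻ v (Valid.unique w′) j i j<i)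

  -- The decomposition at the value 1 as a bijection.

  join : ∀ {l r} → Vec ℕ l → Vec ℕ r → Vec ℕ (l + suc r)
  join {r = r} u v = V.map (suc r +_) u V.++ 1 ∷ V.map suc v

  toList-join : ∀ {l r} (u : Vec ℕ l) (v : Vec ℕ r) → toList (join u v) ≡ joinLists r (toList u) (toList v)
  toList-join {r = r} u v = trans (VP.toList-++ (V.map (suc r +_) u) (1 ∷ V.map suc v))
    (cong₂ (λ s t → s ++ 1 ∷ t) (VP.toList-map (suc r +_) u) (VP.toList-map suc v))

  Vec-map-injective : ∀ {n} {f : ℕ → ℕ} → (∀ {x y} → f x ≡ f y → x ≡ y) →
    ∀ {u v : Vec ℕ n} → V.map f u ≡ V.map f v → u ≡ v
  Vec-map-injective f-inj {[]}    {[]}    _ = refl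
  Vec-map-injective f-inj {_ ∷ _} {_ ∷ _} e =
    cong₂ _∷_ (f-inj (VP.∷-injectiveˡ e)) (Vec-map-injective f-inj (VP.∷-injectiveʳ e))

  join-injective : ∀ {l r} {u u′ : Vec ℕ l} {v v′ : Vec ℕ r} → join u v ≡ join u′ v′ → u ≡ u′ × v ≡ v′
  join-injective {r = r} {u} {u′} e with p , q ← VP.++-injective (V.map (suc r +_) u) (V.map (suc r +_) u′) e =
    Vec-map-injective (+-cancelˡ-≡ (suc r) _ _) p , Vec-map-injective suc-injective (VP.∷-injectiveʳ q)

  -- Reads the size of the left block off a joined list, and so serves as the key that keeps the
  -- blocks apart.
  indexOf1 : List ℕ → ℕ
  indexOf1 (1 ∷ _)  = 0
  indexOf1 (_ ∷ xs) = suc (indexOf1 xs)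
  indexOf1 []       = 0

  indexOf1-join : ∀ r {xs ys} → Positive xs → indexOf1 (joinLists r xs ys) ≡ length xs
  indexOf1-join r [] = refl
  -- The rewriting exposes two successors in the first entry, so that the clause for `1` is seen not
  -- to match and `indexOf1` reduces.
  indexOf1-join r {suc x ∷ xs} (_ ∷ p) rewrite +-suc r x = cong suc (indexOf1-join r p)

  blocks : ℕ → ℕ → List (List ℕ)
  blocks l r = cartesianProductWith (λ u v → toList (join u v)) (Av213 l) (Av213 r)

  positive : ∀ {n v} → v ∈ Av213 n → Positive (toList v)
  positive v∈ = All.map proj₁ (Valid.range (Av213⇒valid v∈))

  ∈-blocks⁻ : ∀ l r {zs} → zs ∈ blocks l r →
    ∃₂ λ xs ys → Valid l xs × Valid r ys × zs ≡ joinLists r xs ys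
  ∈-blocks⁻ l r zs∈ with u , v , u∈ , v∈ , refl ←
      ∈-cartesianProductWith⁻ (λ u v → toList (join u v)) (Av213 l) (Av213 r) zs∈ =
    toList u , toList v , Av213⇒valid u∈ , Av213⇒valid v∈ , toList-join u v

  ∈-blocks⁺ : ∀ {l r xs ys} → Valid l xs → Valid r ys → joinLists r xs ys ∈ blocks l r
  ∈-blocks⁺ {l} {r} vx vy with u , u∈ , refl ← valid⇒Av213 vx | v , v∈ , refl ← valid⇒Av213 vy =
    subst (_∈ blocks l r) (toList-join u v) (∈-cartesianProductWith⁺ (λ u v → toList (join u v)) u∈ v∈)

  -- Two lists without duplicates and with the same elements are permutations of each other, so the
  -- order of enumeration never has to be compared. Lists replace vectors here because `join u v`
  -- has length `l + suc r`, which is not `suc n` by computation.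
  Av213-decomposition : ∀ n → map toList (Av213 (suc n)) ↭ splitList blocks n
  Av213-decomposition n = ∼bag⇒↭ (unique∧set⇒bag
    (UP.map⁺ toList-injective (Av213-unique (suc n)))
    (splitList-unique blocks indexOf1
      (λ l r → UP.cartesianProductWith⁺ _ (join-injective ∘ toList-injective) (Av213-unique l) (Av213-unique r))
      key n)
    (mk⇔ to from))
    where
    key : ∀ l r {zs} → zs ∈ blocks l r → indexOf1 zs ≡ l
    key l r zs∈ with xs , ys , vx , _ , refl ← ∈-blocks⁻ l r zs∈ =
      trans (indexOf1-join r (All.map proj₁ (Valid.range vx))) (Valid.size vx)
    to : ∀ {zs} → zs ∈ map toList (Av213 (suc n)) → zs ∈ splitList blocks n
    to zs∈ with v , v∈ , refl ← ∈-map⁻ toList zs∈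
      with l , r , refl , xs , ys , vx , vy , e ← valid-split (Av213⇒valid v∈) =
      ∈-splitList⁺ blocks l r (subst (_∈ blocks l r) (sym e) (∈-blocks⁺ vx vy))
    from : ∀ {zs} → zs ∈ splitList blocks n → zs ∈ map toList (Av213 (suc n))
    from zs∈ with l , r , refl , zs∈′ ← ∈-splitList⁻ blocks n zs∈
      with xs , ys , vx , vy , refl ← ∈-blocks⁻ l r zs∈′
      with v , v∈ , e ← valid⇒Av213 (valid-join vx vy) = subst (_∈ _) (sym e) (∈-map⁺ toList v∈)

  -- Recurrences for the number of permutations and for the window sums.

  catalan : ℕ → ℕ
  catalan n = length (Av213 n)

  windowTotal : (ℕ → ℕ) → ℕ → ℕ
  windowTotal φ n = sum (map (window φ 0) (map toList (Av213 n)))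

  catalan-suc : ∀ n → catalan (suc n) ≡ splitSum (λ l r → catalan l * catalan r) n
  catalan-suc n = begin
    length (Av213 (suc n))                      ≡⟨ LP.length-map toList (Av213 (suc n)) ⟨
    length (map toList (Av213 (suc n)))         ≡⟨ ↭-length (Av213-decomposition n) ⟩
    length (splitList blocks n)                 ≡⟨ length-splitList blocks n ⟩
    splitSum (λ l r → length (blocks l r)) n
      ≡⟨ splitSum-cong (λ l r → length-cartesianProductWith _ (Av213 l) (Av213 r)) n ⟩
    splitSum (λ l r → catalan l * catalan r) n  ∎
    where open ≡-Reasoning

  -- For `φ = pred` this is an explicit formula rather than a recursion: the blocks enter only
  -- through `windowTotal id`.
  windowTotal-suc : ∀ {φ} → φ 0 ≡ 0 → (∀ k m → φ (suc k + m) ≡ φ (suc k) + m) → ∀ n →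
    windowTotal φ (suc n) ≡ splitSum (λ l r →
      windowTotal id l * catalan r + catalan l * windowTotal id r
        + catalan l * catalan r * (φ (suc r) * (l ∸ 2) + φ 1 * (ι l + (r ∸ 1)))) n
  windowTotal-suc {φ} φ-zero φ-shift n = begin
    sum (map (window φ 0) (map toList (Av213 (suc n))))
      ≡⟨ sum-↭ (map⁺ (window φ 0) (Av213-decomposition n)) ⟩
    sum (map (window φ 0) (splitList blocks n))
      ≡⟨ sum-map-splitList (window φ 0) blocks n ⟩
    splitSum (λ l r → sum (map (window φ 0) (blocks l r))) n
      ≡⟨ splitSum-cong (λ l r → trans
           (sum-cartesianProductWith (λ u v → toList (join u v)) (window φ 0) (window id 0 ∘ toList) (window id 0 ∘ toList)
             (φ (suc r) * (l ∸ 2) + φ 1 * (ι l + (r ∸ 1))) (Av213 l) (Av213 r) (pointwise l r))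
           (cong₂ (λ s t → s * catalan r + catalan l * t
               + catalan l * catalan r * (φ (suc r) * (l ∸ 2) + φ 1 * (ι l + (r ∸ 1))))
             (cong sum (LP.map-∘ (Av213 l))) (cong sum (LP.map-∘ (Av213 r))))) n ⟩
    _ ∎
    where
    open ≡-Reasoning
    pointwise : ∀ l r {u v} → u ∈ Av213 l → v ∈ Av213 r → window φ 0 (toList (join u v)) ≡
      window id 0 (toList u) + window id 0 (toList v) + (φ (suc r) * (l ∸ 2) + φ 1 * (ι l + (r ∸ 1)))
    pointwise l r {u} {v} u∈ v∈ = begin
      window φ 0 (toList (join u v))
        ≡⟨ cong (window φ 0) (toList-join u v) ⟩
      window φ 0 (joinLists r (toList u) (toList v))
        ≡⟨ Windows.window-join {φ} φ-zero φ-shift r (toList u) (toList v) (positive u∈) (positive v∈) ⟩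
      window id 0 (toList u) + window id 0 (toList v)
        + (φ (suc r) * (length (toList u) ∸ 2) + φ 1 * (ι (length (toList u)) + (length (toList v) ∸ 1)))
        ≡⟨ cong₂ (λ s t → window id 0 (toList u) + window id 0 (toList v)
             + (φ (suc r) * (s ∸ 2) + φ 1 * (ι s + (t ∸ 1)))) (VP.length-toList u) (VP.length-toList v) ⟩
      window id 0 (toList u) + window id 0 (toList v) + (φ (suc r) * (l ∸ 2) + φ 1 * (ι l + (r ∸ 1))) ∎

  -- Degrees in the grid graph

  leftOf : ∀ {n} → ℕ → Vec ℕ n → Fin n → ℕ
  leftOf p (x ∷ v) zero    = p
  leftOf p (x ∷ v) (suc i) = leftOf x v i

  rightOf : ∀ {n} → Vec ℕ n → Fin n → ℕ
  rightOf (x ∷ v) zero    = head₀ (toList v)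
  rightOf (x ∷ v) (suc i) = rightOf v i

  leftOf-lookup : ∀ {n} p (v : Vec ℕ n) i i′ → toℕ i ≡ suc (toℕ i′) → leftOf p v i ≡ lookup v i′
  leftOf-lookup p (x ∷ y ∷ v) (suc zero) zero     e = refl
  leftOf-lookup p (x ∷ v)     (suc i)    (suc i′) e = leftOf-lookup x v i i′ (suc-injective e)

  leftOf-neighbour : ∀ {n} (v : Vec ℕ n) i → 1 ≤ leftOf 0 v i → ∃ λ (i′ : Fin n) → toℕ i ≡ suc (toℕ i′)
  leftOf-neighbour (x ∷ v) (suc i) _ = F.inject₁ i , cong suc (sym (FP.toℕ-inject₁ i))

  rightOf-lookup : ∀ {n} (v : Vec ℕ n) i i′ → toℕ i′ ≡ suc (toℕ i) → rightOf v i ≡ lookup v i′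
  rightOf-lookup (x ∷ y ∷ v) zero    (suc zero) e = refl
  rightOf-lookup (x ∷ v)     (suc i) (suc i′)   e = rightOf-lookup v i i′ (suc-injective e)

  rightOf-neighbour : ∀ {n} (v : Vec ℕ n) i → 1 ≤ rightOf v i → ∃ λ (i′ : Fin n) → toℕ i′ ≡ suc (toℕ i)
  rightOf-neighbour (x ∷ y ∷ v) zero    _ = suc zero , refl
  rightOf-neighbour (x ∷ v)     (suc i) p with i′ , e ← rightOf-neighbour v i p = suc i′ , cong suc e

  module _ {n : ℕ} (v : Vec ℕ n) where

    column : Fin n → List (Vertex n)
    column i = map (i ,_) (map suc (upTo (lookup v i)))

    ∈-column⁺ : ∀ {i j} → 1 ≤ j → j ≤ lookup v i → (i , j) ∈ column i
    ∈-column⁺ {i} (s≤s _) j≤ = ∈-map⁺ (i ,_) (∈-map⁺ suc (∈-upTo⁺ j≤))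

    ∈-column⁻ : ∀ {i w} → w ∈ column i → proj₁ w ≡ i × 1 ≤ proj₂ w × proj₂ w ≤ lookup v i
    ∈-column⁻ {i} w∈ with _ , j∈ , refl ← ∈-map⁻ (i ,_) w∈ with _ , k∈ , refl ← ∈-map⁻ suc j∈ =
      refl , s≤s z≤n , ∈-upTo⁻ k∈

    column-unique : ∀ i → Unique (column i)
    column-unique i = UP.map⁺ ,-injectiveʳ (UP.map⁺ suc-injective (UP.upTo⁺ _))

    ∈-vertices⁺ : ∀ {i j} → 1 ≤ j → j ≤ lookup v i → (i , j) ∈ vertices v
    ∈-vertices⁺ {i} p q = ∈-concatMap⁺ column (lose (∈-allFin i) (∈-column⁺ p q))

    ∈-vertices⁻ : ∀ {i j} → (i , j) ∈ vertices v → 1 ≤ j × j ≤ lookup v i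
    ∈-vertices⁻ p with i , _ , q ← find (∈-concatMap⁻ column {xs = allFin n} p) with refl , r ← ∈-column⁻ q = r

    vertices-unique : Unique (vertices v)
    vertices-unique = UP.concat⁺ (AllP.map⁺ (All.universal column-unique (allFin n)))
      (APP.map⁺ (AP.map (λ i≢i′ {_} (p , q) → i≢i′ (trans (sym (proj₁ (∈-column⁻ p))) (proj₁ (∈-column⁻ q))))
        (UP.allFin⁺ n)))

    Surrounded : Vertex n → Set
    Surrounded (i , j) = 2 ≤ j × suc j ≤ lookup v i × j ≤ leftOf 0 v i × j ≤ rightOf v i

    surrounded? : Decidable Surrounded
    surrounded? (i , j) = (2 ≤? j) ×-dec (suc j ≤? lookup v i) ×-dec (j ≤? leftOf 0 v i) ×-dec (j ≤? rightOf v i)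

    -- Shifting the column index by one lets the left neighbour of the first column have a code too.
    code : Vertex n → ℕ × ℕ
    code (i , j) = suc (toℕ i) , j

    code-injective : ∀ {w w′} → code w ≡ code w′ → w ≡ w′
    code-injective e =
      cong₂ _,_ (FP.toℕ-injective (suc-injective (,-injectiveˡ e))) (,-injectiveʳ e)

    module _ (i : Fin n) (j : ℕ) where

      neighbours : List (Vertex n)
      neighbours = filter (adj? (i , j)) (vertices v)

      up down left right : ℕ × ℕ
      up    = suc (toℕ i) , suc j
      down  = suc (toℕ i) , pred j
      left  = toℕ i , j
      right = suc (suc (toℕ i)) , j

      data Neighbour (w : ℕ × ℕ) : Set where
        isUp    : w ≡ up → suc j ≤ lookup v i → Neighbour w
        isDown  : w ≡ down → 2 ≤ j → Neighbour w
        isLeft  : w ≡ left → j ≤ leftOf 0 v i → Neighbour w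
        isRight : w ≡ right → j ≤ rightOf v i → Neighbour w

      classify : ∀ {w} → w ∈ map code neighbours → Neighbour w
      classify w∈ with (i′ , j′) , u∈ , refl ← ∈-map⁻ code w∈
        with u∈v , adj ← ∈-filter⁻ (adj? (i , j)) {xs = vertices v} u∈
        with 1≤j′ , j′≤ ← ∈-vertices⁻ u∈v
        with adj
      ... | inj₁ (refl , inj₁ refl)  = isDown refl (s≤s 1≤j′)
      ... | inj₁ (refl , inj₂ refl)  = isUp refl j′≤
      ... | inj₂ (inj₁ e , refl) = isLeft (cong (_, j) (sym e))
        (subst (j ≤_) (sym (leftOf-lookup 0 v i i′ e)) j′≤)
      ... | inj₂ (inj₂ e , refl) = isRight (cong (λ t → suc t , j) e)
        (subst (j ≤_) (sym (rightOf-lookup v i i′ e)) j′≤)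

      degree≤ : ∀ {ws} → (∀ {w} → Neighbour w → w ∈ ws) → degree v (i , j) ≤ length ws
      degree≤ sub = subst (_≤ _) (LP.length-map code neighbours)
        (unique-⊆⇒length≤ (UP.map⁺ code-injective (UP.filter⁺ (adj? (i , j)) vertices-unique)) (sub ∘ classify))

      -- If one of the four inequalities fails, `Neighbour` leaves one direction vacant. The codes
      -- of the neighbours then fit into a list of three, against degree 4.
      degree-4⇒surrounded : degree v (i , j) ≡ 4 → Surrounded (i , j)
      degree-4⇒surrounded d =
          decidable-stable (2 ≤? j) (λ ¬p → absurd (degree≤ {up ∷ left ∷ right ∷ []} λ
            { (isUp e _) → here e ; (isDown _ p) → contradiction p ¬p
            ; (isLeft e _) → there (here e) ; (isRight e _) → there (there (here e)) }))
        , decidable-stable (suc j ≤? lookup v i) (λ ¬p → absurd (degree≤ {down ∷ left ∷ right ∷ []} λ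
            { (isUp _ p) → contradiction p ¬p ; (isDown e _) → here e
            ; (isLeft e _) → there (here e) ; (isRight e _) → there (there (here e)) }))
        , decidable-stable (j ≤? leftOf 0 v i) (λ ¬p → absurd (degree≤ {up ∷ down ∷ right ∷ []} λ
            { (isUp e _) → here e ; (isDown e _) → there (here e)
            ; (isLeft _ p) → contradiction p ¬p ; (isRight e _) → there (there (here e)) }))
        , decidable-stable (j ≤? rightOf v i) (λ ¬p → absurd (degree≤ {up ∷ down ∷ left ∷ []} λ
            { (isUp e _) → here e ; (isDown e _) → there (here e)
            ; (isLeft e _) → there (there (here e)) ; (isRight _ p) → contradiction p ¬p }))
        where
        absurd : ¬ degree v (i , j) ≤ 3
        absurd p = contradiction (subst (_≤ 3) d p) (n≮n 3)

    surrounded⇒degree-4 : ∀ i j → Surrounded (i , j) → degree v (i , j) ≡ 4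
    surrounded⇒degree-4 i (suc zero) (s≤s () , _)
    surrounded⇒degree-4 i j@(suc k@(suc _)) (_ , j< , j≤l , j≤r)
      with l , el ← leftOf-neighbour v i (≤-trans (s≤s z≤n) j≤l)
         | r , er ← rightOf-neighbour v i (≤-trans (s≤s z≤n) j≤r) =
      ≤-antisym (degree≤ i j {four} λ
          { (isUp e _) → here e ; (isDown e _) → there (here e)
          ; (isLeft e _) → there (there (here e)) ; (isRight e _) → there (there (there (here e))) })
        (subst (4 ≤_) (LP.length-map code (neighbours i j)) (unique-⊆⇒length≤ distinct present))
      where
      four : List (ℕ × ℕ)
      four = up i j ∷ down i j ∷ left i j ∷ right i j ∷ []
      distinct : Unique four
      -- Only left and right need an argument: they have the same height, and their columns differ
      -- by 2.
      distinct = ((λ ()) ∷ (λ ()) ∷ (λ ()) ∷ []) ∷ ((λ ()) ∷ (λ ()) ∷ []) ∷ ((λ e → m≢1+n+m (toℕ i) {1} (,-injectiveˡ e)) ∷ []) ∷ [] ∷ []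
      neighbour : ∀ {i′ j′} → 1 ≤ j′ → j′ ≤ lookup v i′ → Adj (i , j) (i′ , j′) →
        (suc (toℕ i′) , j′) ∈ map code (neighbours i j)
      neighbour p q a = ∈-map⁺ code (∈-filter⁺ (adj? (i , j)) (∈-vertices⁺ p q) a)
      present : ∀ {w} → w ∈ four → w ∈ map code (neighbours i j)
      present (here refl) = neighbour (s≤s z≤n) j< (inj₁ (refl , inj₂ refl))
      present (there (here refl)) =
        neighbour (s≤s z≤n) (≤-trans (n≤1+n k) (<⇒≤ j<)) (inj₁ (refl , inj₁ refl))
      present (there (there (here refl))) = subst (λ t → (t , j) ∈ map code (neighbours i j)) (sym el)
        (neighbour (s≤s z≤n) (subst (j ≤_) (leftOf-lookup 0 v i l el) j≤l) (inj₂ (inj₁ el , refl)))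
      present (there (there (there (here refl)))) = subst (λ t → (suc t , j) ∈ map code (neighbours i j)) er
        (neighbour (s≤s z≤n) (subst (j ≤_) (rightOf-lookup v i r er) j≤r) (inj₂ (inj₂ er , refl)))

    -- The surrounded heights are 2, ..., m, where m is the minimum. Truncation in `pred` gives the
    -- right count 0 for m = 0 as well as for m = 1.
    count-column : ∀ i → length (filter surrounded? (column i))
      ≡ pred (leftOf 0 v i ⊓ (lookup v i ∸ 1) ⊓ rightOf v i)
    count-column i = trans (≤-antisym
        (unique-⊆⇒length≤ (UP.filter⁺ surrounded? (column-unique i)) to)
        (unique-⊆⇒length≤ (UP.map⁺ (suc-injective ∘ suc-injective ∘ ,-injectiveʳ) (UP.upTo⁺ (pred m))) from))
      (trans (LP.length-map _ (upTo (pred m))) (length-upTo (pred m)))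
      where
      m = leftOf 0 v i ⊓ (lookup v i ∸ 1) ⊓ rightOf v i
      range = map (λ k → i , suc (suc k)) (upTo (pred m))
      to : ∀ {w} → w ∈ filter surrounded? (column i) → w ∈ range
      to w∈ with w∈c , s ← ∈-filter⁻ surrounded? {xs = column i} w∈ with refl , _ ← ∈-column⁻ w∈c
        with s≤s (s≤s _) , j< , j≤l , j≤r ← s =
        ∈-map⁺ (λ k → i , suc (suc k)) (∈-upTo⁺ (∸-monoˡ-≤ 1 (⊓-glb (⊓-glb j≤l (∸-monoˡ-≤ 1 j<)) j≤r)))
      suc-<-pred : ∀ {a b} → a < b ∸ 1 → suc a < b
      suc-<-pred {b = suc b} p = s≤s p
      from : ∀ {w} → w ∈ range → w ∈ filter surrounded? (column i)
      from w∈ with k , k∈ , refl ← ∈-map⁻ (λ k → i , suc (suc k)) w∈ =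
        let j≤m = suc-<-pred (∈-upTo⁻ k∈)
            j≤l⊓ = ≤-trans j≤m (m⊓n≤m (leftOf 0 v i ⊓ (lookup v i ∸ 1)) (rightOf v i))
            j< = suc-<-pred (≤-trans j≤l⊓ (m⊓n≤n (leftOf 0 v i) _))
        in ∈-filter⁺ surrounded? (∈-column⁺ (s≤s z≤n) (<⇒≤ j<))
          (s≤s (s≤s z≤n) , j< , ≤-trans j≤l⊓ (m⊓n≤m _ _) , ≤-trans j≤m (m⊓n≤n _ _))

  length-filter-concatMap : ∀ {A B : Set} {P : B → Set} (P? : Decidable P) (f : A → List B) xs →
    length (filter P? (concatMap f xs)) ≡ sum (map (λ x → length (filter P? (f x))) xs)
  length-filter-concatMap P? f []       = refl
  length-filter-concatMap P? f (x ∷ xs) = trans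
    (cong length (LP.filter-++ P? (f x) (concatMap f xs)))
    (trans (LP.length-++ (filter P? (f x)))
      (cong (length (filter P? (f x)) +_) (length-filter-concatMap P? f xs)))

  sum-window : ∀ {n} p (v : Vec ℕ n) →
    sum (tabulate λ i → pred (leftOf p v i ⊓ (lookup v i ∸ 1) ⊓ rightOf v i)) ≡ window pred p (toList v)
  sum-window p []      = refl
  sum-window p (x ∷ v) = cong (pred (p ⊓ (x ∸ 1) ⊓ head₀ (toList v)) +_) (sum-window x v)

  deg4count-window : ∀ {n} (v : Vec ℕ n) → deg4count v ≡ window pred 0 (toList v)
  deg4count-window {n} v = begin
    length (filter (λ w → degree v w ℕ.≟ 4) (vertices v))
      ≡⟨ cong length (LP.filter-≐ (λ w → degree v w ℕ.≟ 4) (surrounded? v)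
           ((λ {w} → degree-4⇒surrounded v (proj₁ w) (proj₂ w)) , (λ {w} → surrounded⇒degree-4 v (proj₁ w) (proj₂ w)))
           (vertices v)) ⟩
    length (filter (surrounded? v) (vertices v))
      ≡⟨ length-filter-concatMap (surrounded? v) (column v) (allFin n) ⟩
    sum (map (λ i → length (filter (surrounded? v) (column v i))) (allFin n))
      ≡⟨ cong sum (LP.map-cong (count-column v) (allFin n)) ⟩
    sum (map (λ i → pred (leftOf 0 v i ⊓ (lookup v i ∸ 1) ⊓ rightOf v i)) (allFin n))
      ≡⟨ cong sum (LP.map-tabulate id (λ i → pred (leftOf 0 v i ⊓ (lookup v i ∸ 1) ⊓ rightOf v i))) ⟩
    sum (tabulate λ i → pred (leftOf 0 v i ⊓ (lookup v i ∸ 1) ⊓ rightOf v i))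
      ≡⟨ sum-window 0 v ⟩
    window pred 0 (toList v) ∎
    where open ≡-Reasoning

  Q4-windowTotal : ∀ n → Q4 n ≡ windowTotal pred n
  Q4-windowTotal n = cong sum (trans (LP.map-cong deg4count-window (Av213 n)) (LP.map-∘ (Av213 n)))

open import Data.Nat.Combinatorics using (_C_; nCk≡n!/k![n-k]!)
open import Data.Nat.DivMod using (m*n/n≡m; /-congˡ; /-congʳ)
open import Data.Integer using (ℤ; +_; _+_; _-_; _*_; -_)
import Data.Integer as ℤ
import Data.Integer.Properties as ℤP
open import Data.Integer.Tactic.RingSolver using (solve-∀)

-- Formal power series over ℤ

Series : Set
Series = ℕ → ℤ

infix 4 _≈_
infixl 6 _⊕_
infixl 7 _⊛_

_≈_ : Series → Series → Set
f ≈ g = ∀ n → f n ≡ g n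

-- The Cauchy product follows the recursion of `splitSum`, so the recurrences turn into products of
-- series by a direct induction.
_⊕_ _⊛_ : Series → Series → Series
(f ⊕ g) n = f n + g n
(f ⊛ g) zero    = f 0 * g 0
(f ⊛ g) (suc n) = f 0 * g (suc n) + ((f ∘ suc) ⊛ g) n

⊖_ : Series → Series
(⊖ f) n = - f n

κ : ℤ → Series
κ z zero    = z
κ z (suc _) = + 0

X : Series
X zero    = + 0
X (suc n) = κ (+ 1) n

-- The Euler operator x d/dx, a derivation that moves no coefficient to another index.
θ : Series → Series
θ f n = + n * f n

⊛-cong : ∀ {f f′ g g′} → f ≈ f′ → g ≈ g′ → f ⊛ g ≈ f′ ⊛ g′
⊛-cong p q zero    = cong₂ _*_ (p 0) (q 0)
⊛-cong p q (suc n) = cong₂ _+_ (cong₂ _*_ (p 0) (q (suc n))) (⊛-cong (p ∘ suc) q n)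

-- The mirror image of the defining recursion, on which commutativity rests.
⊛-sucʳ : ∀ f g n → (f ⊛ g) (suc n) ≡ (f ⊛ (g ∘ suc)) n + f (suc n) * g 0
⊛-sucʳ f g zero    = refl
⊛-sucʳ f g (suc n) =
  trans (cong (_+_ (f 0 * g (suc (suc n)))) (⊛-sucʳ (f ∘ suc) g n)) 
        (sym (ℤP.+-assoc (f 0 * g (suc (suc n))) _ _))

⊛-comm : ∀ f g → f ⊛ g ≈ g ⊛ f
⊛-comm f g zero    = ℤP.*-comm (f 0) (g 0)
⊛-comm f g (suc n) = begin
  f 0 * g (suc n) + ((f ∘ suc) ⊛ g) n  ≡⟨ ℤP.+-comm (f 0 * g (suc n)) _ ⟩
  ((f ∘ suc) ⊛ g) n + f 0 * g (suc n)  ≡⟨ cong₂ _+_ (⊛-comm (f ∘ suc) g n) (ℤP.*-comm (f 0) _) ⟩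
  (g ⊛ (f ∘ suc)) n + g (suc n) * f 0  ≡⟨ ⊛-sucʳ g f n ⟨
  (g ⊛ f) (suc n)                      ∎
  where open ≡-Reasoning

⊛-distribʳ : ∀ h f g → (f ⊕ g) ⊛ h ≈ f ⊛ h ⊕ g ⊛ h
⊛-distribʳ h f g zero    = ℤP.*-distribʳ-+ (h 0) (f 0) (g 0)
⊛-distribʳ h f g (suc n) =
  trans (cong (_+_ ((f 0 + g 0) * h (suc n))) (⊛-distribʳ h (f ∘ suc) (g ∘ suc) n))
        (lem (f 0) (g 0) (h (suc n)) _ _)
  where
  lem : ∀ a b c p q → (a + b) * c + (p + q) ≡ (a * c + p) + (b * c + q)
  lem = solve-∀

scale-⊛ : ∀ a f g n → ((λ m → a * f m) ⊛ g) n ≡ a * (f ⊛ g) n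
scale-⊛ a f g zero    = ℤP.*-assoc a (f 0) (g 0)
scale-⊛ a f g (suc n) = trans (cong (_+_ (a * f 0 * g (suc n))) (scale-⊛ a (f ∘ suc) g n))
  (lem a (f 0) (g (suc n)) _)
  where
  lem : ∀ a b c p → a * b * c + a * p ≡ a * (b * c + p)
  lem = solve-∀

⊛-assoc : ∀ f g h → (f ⊛ g) ⊛ h ≈ f ⊛ (g ⊛ h)
⊛-assoc f g h zero    = ℤP.*-assoc (f 0) (g 0) (h 0)
⊛-assoc f g h (suc n) = begin
  f 0 * g 0 * h (suc n) + (((λ m → f 0 * g (suc m)) ⊕ ((f ∘ suc) ⊛ g)) ⊛ h) n
    ≡⟨ cong (_+_ (f 0 * g 0 * h (suc n)))
         (trans (⊛-distribʳ h (λ m → f 0 * g (suc m)) ((f ∘ suc) ⊛ g) n)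
           (cong₂ _+_ (scale-⊛ (f 0) (g ∘ suc) h n) (⊛-assoc (f ∘ suc) g h n))) ⟩
  f 0 * g 0 * h (suc n) + (f 0 * ((g ∘ suc) ⊛ h) n + ((f ∘ suc) ⊛ (g ⊛ h)) n)
    ≡⟨ lem (f 0) (g 0) (h (suc n)) _ _ ⟩
  f 0 * (g 0 * h (suc n) + ((g ∘ suc) ⊛ h) n) + ((f ∘ suc) ⊛ (g ⊛ h)) n ∎
  where
  open ≡-Reasoning
  lem : ∀ a b c p q → a * b * c + (a * p + q) ≡ a * (b * c + p) + q
  lem = solve-∀

zero-⊛ : ∀ g n → ((λ _ → + 0) ⊛ g) n ≡ + 0
zero-⊛ g zero    = refl
zero-⊛ g (suc n) = trans (ℤP.+-identityˡ _) (zero-⊛ g n)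

κ-⊛ : ∀ z g n → (κ z ⊛ g) n ≡ z * g n
κ-⊛ z g zero    = refl
κ-⊛ z g (suc n) = trans (cong (_+_ (z * g (suc n))) (zero-⊛ g n)) (ℤP.+-identityʳ _)

X-⊛ : ∀ g n → (X ⊛ g) (suc n) ≡ g n
X-⊛ g n = trans (ℤP.+-identityˡ _) (trans (κ-⊛ (+ 1) g n) (ℤP.*-identityˡ (g n)))

⊛-identityˡ : ∀ g → κ (+ 1) ⊛ g ≈ g
⊛-identityˡ g n = trans (κ-⊛ (+ 1) g n) (ℤP.*-identityˡ (g n))

-- The Leibniz rule. The induction shifts `f` to `f ∘ suc`, and θ does not commute with this shift:
-- the shift of `θ f` is `f′ ⊕ θ f′`, which accounts for the regrouping.
θ-⊛ : ∀ f g → θ (f ⊛ g) ≈ θ f ⊛ g ⊕ f ⊛ θ g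
θ-⊛ f g zero    = lem (f 0) (g 0)
  where
  lem : ∀ a b → + 0 * (a * b) ≡ + 0 * a * b + a * (+ 0 * b)
  lem = solve-∀
θ-⊛ f g (suc n) = begin
  + suc n * (f 0 * g (suc n) + (f′ ⊛ g) n)
    ≡⟨ lem₁ (+ n) (f 0) (g (suc n)) ((f′ ⊛ g) n) ⟩
  f 0 * (+ suc n * g (suc n)) + ((f′ ⊛ g) n + θ (f′ ⊛ g) n)
    ≡⟨ cong (λ t → f 0 * (+ suc n * g (suc n)) + ((f′ ⊛ g) n + t)) (θ-⊛ f′ g n) ⟩
  f 0 * (+ suc n * g (suc n)) + ((f′ ⊛ g) n + ((θ f′ ⊛ g) n + (f′ ⊛ θ g) n))
    ≡⟨ lem₂ (f 0) (g (suc n)) (f 0 * (+ suc n * g (suc n)))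
         ((f′ ⊛ g) n) ((θ f′ ⊛ g) n) ((f′ ⊛ θ g) n) ⟩
  + 0 * f 0 * g (suc n) + ((f′ ⊛ g) n + (θ f′ ⊛ g) n)
    + (f 0 * (+ suc n * g (suc n)) + (f′ ⊛ θ g) n)
    ≡⟨ cong (λ t → + 0 * f 0 * g (suc n) + t + (f 0 * (+ suc n * g (suc n)) + (f′ ⊛ θ g) n))
         (trans (sym (⊛-distribʳ g f′ (θ f′) n))
                (⊛-cong (λ m → sym (lem₃ (+ m) (f′ m))) (λ _ → refl) n)) ⟩
  (θ f ⊛ g ⊕ f ⊛ θ g) (suc n) ∎
  where
  open ≡-Reasoning
  f′ = f ∘ suc
  lem₁ : ∀ m a b c → (+ 1 + m) * (a * b + c) ≡ a * ((+ 1 + m) * b) + (c + m * c)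
  lem₁ = solve-∀
  lem₂ : ∀ a b p q r s → p + (q + (r + s)) ≡ + 0 * a * b + (q + r) + (p + s)
  lem₂ = solve-∀
  lem₃ : ∀ m a → (+ 1 + m) * a ≡ a + m * a
  lem₃ = solve-∀

seriesRing : CommutativeRing 0ℓ 0ℓ
seriesRing = record
  { Carrier = Series
  ; _≈_ = _≈_
  ; _+_ = _⊕_
  ; _*_ = _⊛_
  ; -_  = ⊖_
  ; 0#  = λ _ → + 0
  ; 1#  = κ (+ 1)
  ; isCommutativeRing = record
    { isRing = record
      { +-isAbelianGroup = record
        { isGroup = record
          { isMonoid = record
            { isSemigroup = record
              { isMagma = record
                { isEquivalence = record
                  { refl = λ _ → refl
                  ; sym = λ p n → sym (p n)
                  ; trans = λ p q n → trans (p n) (q n) }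
                ; ∙-cong = λ p q n → cong₂ _+_ (p n) (q n) }
              ; assoc = λ f g h n → ℤP.+-assoc (f n) (g n) (h n) }
            ; identity = (λ f n → ℤP.+-identityˡ (f n)) , (λ f n → ℤP.+-identityʳ (f n)) }
          ; inverse = (λ f n → ℤP.+-inverseˡ (f n)) , (λ f n → ℤP.+-inverseʳ (f n))
          ; ⁻¹-cong = λ p n → cong -_ (p n) }
        ; comm = λ f g n → ℤP.+-comm (f n) (g n) }
      ; *-cong = ⊛-cong
      ; *-assoc = ⊛-assoc
      ; *-identity = ⊛-identityˡ , (λ f n → trans (⊛-comm f (κ (+ 1)) n) (⊛-identityˡ f n))
      ; distrib = (λ f g h n → trans (⊛-comm f (g ⊕ h) n)
                     (trans (⊛-distribʳ f g h n) (cong₂ _+_ (⊛-comm g f n) (⊛-comm h f n))))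
                , ⊛-distribʳ }
    ; *-comm = ⊛-comm } }

-- The ring solver compares coefficients by a decision procedure, which is available for integers
-- but not for series; integers therefore enter as constant series.
κ-morphism : CommutativeRing.rawRing ℤP.+-*-commutativeRing
               -Raw-AlmostCommutative⟶ fromCommutativeRing seriesRing
κ-morphism = record
  { ⟦_⟧    = κ
  ; +-homo = λ { a b zero → refl ; a b (suc n) → refl }
  ; *-homo = λ { a b zero → refl ; a b (suc n) → sym (trans (κ-⊛ a (κ b) (suc n)) (ℤP.*-zeroʳ a)) }
  ; -‿homo = λ { a zero → refl ; a (suc n) → refl }
  ; 0-homo = λ { zero → refl ; (suc n) → refl }
  ; 1-homo = λ _ → refl }

-- Consequences of the defining equations, valid in any commutative ring; each is verified by
-- exhibiting the difference of the two sides as a combination of the differences of the hypotheses.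
module Elimination
  (R : CommutativeRing 0ℓ 0ℓ)
  (morphism : CommutativeRing.rawRing ℤP.+-*-commutativeRing
                -Raw-AlmostCommutative⟶ fromCommutativeRing R)
  where

  open CommutativeRing R renaming (_+_ to _⊞_; _*_ to _⊠_; -_ to ⊟_; _≈_ to _≋_)
    using (Carrier; +-cong; *-cong; -‿inverseʳ)
  private module R = CommutativeRing R
  open _-Raw-AlmostCommutative⟶_ morphism using (⟦_⟧)
  open Algebra.Solver.Ring _ (fromCommutativeRing R) morphism
    (λ a b → Maybe.map (λ p → R.reflexive (cong ⟦_⟧ p)) (dec⇒maybe (a ℤ.≟ b)))
    using (solve; _:=_; _:+_; _:*_; :-_; con)

  infix 4 _≋0
  _≋0 : Carrier → Set
  a ≋0 = a ≋ ⟦ + 0 ⟧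

  diff : ∀ {a b} → a ≋ b → (a ⊞ ⊟ b) ≋0
  diff {a} {b} p = R.trans (+-cong p R.refl)
    (R.trans (-‿inverseʳ b) (R.sym (_-Raw-AlmostCommutative⟶_.0-homo morphism)))

  undiff : ∀ {a b} → (a ⊞ ⊟ b) ≋0 → a ≋ b
  undiff {a} {b} p = R.trans (solve 2 (λ a b → a := (a :+ :- b) :+ b) R.refl a b)
    (R.trans (+-cong p R.refl) (solve 1 (λ b → con (+ 0) :+ b := b) R.refl b))

  infixl 6 _⟨+⟩_
  _⟨+⟩_ : ∀ {a b} → a ≋0 → b ≋0 → (a ⊞ b) ≋0
  p ⟨+⟩ q = R.trans (+-cong p q) (solve 0 (con (+ 0) :+ con (+ 0) := con (+ 0)) R.refl)

  infixr 7 _⟨*⟩_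
  _⟨*⟩_ : ∀ k {a} → a ≋0 → (k ⊠ a) ≋0
  k ⟨*⟩ p = R.trans (*-cong R.refl p) (solve 1 (λ k → k :* con (+ 0) := con (+ 0)) R.refl k)

  -- Expanding gives s² = 1 - 4x(c - xc²), and the last factor is 1.
  S² : ∀ {x c} → c ≋ ⟦ + 1 ⟧ ⊞ x ⊠ (c ⊠ c) →
    let s = ⟦ + 1 ⟧ ⊞ ⟦ - + 2 ⟧ ⊠ (x ⊠ c) in s ⊠ s ≋ ⟦ + 1 ⟧ ⊞ ⟦ - + 4 ⟧ ⊠ x
  S² {x} {c} w = undiff (R.trans
    (solve 2 (λ x c → let s = con (+ 1) :+ con (- + 2) :* (x :* c) in
        s :* s :+ :- (con (+ 1) :+ con (- + 4) :* x)
          := con (- + 4) :* x :* (c :+ :- (con (+ 1) :+ x :* (c :* c)))) R.refl x c)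
    (_ ⟨*⟩ diff w))

  -- Here `d` stands for θ s, so the left side is θ of s².
  square-derivative : ∀ {x b s d} → d ≋ ⟦ - + 2 ⟧ ⊠ (x ⊠ b) →
    d ⊠ s ⊞ s ⊠ d ≋ ⟦ - + 4 ⟧ ⊠ (x ⊠ (s ⊠ b))
  square-derivative {x} {b} {s} p = R.trans
    (+-cong (*-cong p R.refl) (*-cong R.refl p))
    (solve 3 (λ x b s → con (- + 2) :* (x :* b) :* s :+ s :* (con (- + 2) :* (x :* b))
        := con (- + 4) :* (x :* (s :* b))) R.refl x b s)

  -- Here `d` and `t` stand for θ s and θ b, and the second hypothesis is θ applied to sb = 1.
  inverse-derivative : ∀ {x b s d t} → d ≋ ⟦ - + 2 ⟧ ⊠ (x ⊠ b) → (d ⊠ b ⊞ s ⊠ t) ≋0 →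
    s ⊠ t ≋ ⟦ + 2 ⟧ ⊠ (x ⊠ (b ⊠ b))
  inverse-derivative {x} {b} {s} {d} {t} p q = undiff (R.trans
    (solve 5 (λ x b s d t → s :* t :+ :- (con (+ 2) :* (x :* (b :* b)))
        := con (+ 1) :* (d :* b :+ s :* t) :+ :- b :* (d :+ :- (con (- + 2) :* (x :* b))))
      R.refl x b s d t)
    (_ ⟨*⟩ q ⟨+⟩ _ ⟨*⟩ diff p))

  module _ {x b c : Carrier} (w : c ≋ ⟦ + 1 ⟧ ⊞ x ⊠ (c ⊠ c))
    (v : (⟦ + 1 ⟧ ⊞ ⟦ - + 2 ⟧ ⊠ (x ⊠ c)) ⊠ b ≋ ⟦ + 1 ⟧) where

    B² : b ⊠ b ≋ ⟦ + 1 ⟧ ⊞ ⟦ + 4 ⟧ ⊠ (x ⊠ (b ⊠ b))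
    B² = undiff (R.trans
      (solve 3 (λ x b c → let s = con (+ 1) :+ con (- + 2) :* (x :* c) in
          b :* b :+ :- (con (+ 1) :+ con (+ 4) :* (x :* (b :* b)))
            := con (+ 4) :* x :* b :* b :* (c :+ :- (con (+ 1) :+ x :* (c :* c)))
               :+ (s :* b :+ con (+ 1)) :* (s :* b :+ :- con (+ 1))) R.refl x b c)
      (_ ⟨*⟩ diff w ⟨+⟩ _ ⟨*⟩ diff v))

    BC : b ≋ ⟦ + 1 ⟧ ⊞ ⟦ + 2 ⟧ ⊠ (x ⊠ (b ⊠ c))
    BC = undiff (R.trans
      (solve 3 (λ x b c → b :+ :- (con (+ 1) :+ con (+ 2) :* (x :* (b :* c)))
            := con (+ 1) :* ((con (+ 1) :+ con (- + 2) :* (x :* c)) :* b :+ :- con (+ 1)))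
        R.refl x b c)
      (_ ⟨*⟩ diff v))

    module _ {t : Carrier} (d : (⟦ + 1 ⟧ ⊞ ⟦ - + 2 ⟧ ⊠ (x ⊠ c)) ⊠ t ≋ ⟦ + 2 ⟧ ⊠ (x ⊠ (b ⊠ b))) where

      θB : t ≋ ⟦ + 2 ⟧ ⊠ (x ⊠ (b ⊠ (b ⊠ b)))
      θB = undiff (R.trans
        (solve 4 (λ x b c t → let s = con (+ 1) :+ con (- + 2) :* (x :* c) in
            t :+ :- (con (+ 2) :* (x :* (b :* (b :* b))))
              := :- t :* (s :* b :+ :- con (+ 1))
                 :+ b :* (s :* t :+ :- (con (+ 2) :* (x :* (b :* b))))) R.refl x b c t)
        (_ ⟨*⟩ diff v ⟨+⟩ _ ⟨*⟩ diff d))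

      -- Multiply t = 2xb³ by 1 - 4x, which is the inverse of b². Coefficientwise this is the
      -- recurrence of the central binomial coefficients.
      θB-recurrence : t ≋ ⟦ + 4 ⟧ ⊠ (x ⊠ t) ⊞ ⟦ + 2 ⟧ ⊠ (x ⊠ b)
      θB-recurrence = undiff (R.trans
        (solve 3 (λ x b t →
            t :+ :- (con (+ 4) :* (x :* t) :+ con (+ 2) :* (x :* b))
              := (con (+ 1) :+ con (- + 4) :* x)
                   :* (t :+ :- (con (+ 2) :* (x :* (b :* (b :* b)))))
                 :+ con (+ 2) :* x :* b
                   :* (b :* b :+ :- (con (+ 1) :+ con (+ 4) :* (x :* (b :* b))))) R.refl x b t)
        (_ ⟨*⟩ diff θB ⟨+⟩ _ ⟨*⟩ diff B²))

      module _ {p τ g : Carrier}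
        (p-def : p ≋ b ⊞ ⟦ - + 3 ⟧ ⊠ c ⊞ ⟦ + 2 ⟧ ⊞ x)
        (τ-def : τ ≋ c ⊞ ⟦ - + 1 ⟧ ⊞ ⟦ - + 1 ⟧ ⊠ x)
        (u : g ≋ x ⊠ (⟦ + 2 ⟧ ⊠ (c ⊠ g) ⊞ b ⊠ p ⊞ (c ⊠ (p ⊞ τ) ⊞ c ⊠ τ))) where

        private
          u′ : g ≋ x ⊠ (⟦ + 2 ⟧ ⊠ (c ⊠ g) ⊞ b ⊠ (b ⊞ ⟦ - + 3 ⟧ ⊠ c ⊞ ⟦ + 2 ⟧ ⊞ x)
            ⊞ (c ⊠ ((b ⊞ ⟦ - + 3 ⟧ ⊠ c ⊞ ⟦ + 2 ⟧ ⊞ x) ⊞ (c ⊞ ⟦ - + 1 ⟧ ⊞ ⟦ - + 1 ⟧ ⊠ x))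
               ⊞ c ⊠ (c ⊞ ⟦ - + 1 ⟧ ⊞ ⟦ - + 1 ⟧ ⊠ x)))
          u′ = R.trans u (*-cong R.refl (+-cong (+-cong R.refl (*-cong R.refl p-def))
            (+-cong (*-cong R.refl (+-cong p-def τ-def)) (*-cong R.refl τ-def))))

        -- Hypothesis `u` says (1 - 2xc) g = x(bp + cp + 2cτ). Multiplying by 2b isolates 2g, and
        -- the cubic term 2xb³ that appears is `t`.
        G-closed : ⟦ + 2 ⟧ ⊠ g ⊞ ⟦ + 2 ⟧ ⊠ (b ⊠ b) ⊞ ⟦ + 2 ⟧ ⊠ (b ⊠ c) ⊞ x ⊠ b
          ≋ t ⊞ ⟦ + 4 ⟧ ⊠ b ⊞ ⟦ + 4 ⟧ ⊠ (x ⊠ (b ⊠ b)) ⊞ ⟦ + 2 ⟧ ⊠ (x ⊠ (x ⊠ (b ⊠ b))) ⊞ x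
        G-closed = undiff (R.trans
          (solve 5 (λ x b c t g →
            let p = b :+ con (- + 3) :* c :+ con (+ 2) :+ x
                τ = c :+ con (- + 1) :+ con (- + 1) :* x in
            (con (+ 2) :* g :+ con (+ 2) :* (b :* b) :+ con (+ 2) :* (b :* c) :+ x :* b)
            :+ :- (t :+ con (+ 4) :* b :+ con (+ 4) :* (x :* (b :* b))
                   :+ con (+ 2) :* (x :* (x :* (b :* b))) :+ x)
            := con (+ 2) :* b :* (g :+ :- (x :* (con (+ 2) :* (c :* g) :+ b :* p
                                                 :+ (c :* (p :+ τ) :+ c :* τ))))
               :+ (con (+ 2) :* b :+ x :+ con (- + 2) :* g)
                    :* ((con (+ 1) :+ con (- + 2) :* (x :* c)) :* b :+ :- con (+ 1))
               :+ con (+ 2) :* b :* (c :+ :- (con (+ 1) :+ x :* (c :* c)))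
               :+ con (- + 1) :* (t :+ :- (con (+ 2) :* (x :* (b :* (b :* b))))))
            R.refl x b c t g)
          (_ ⟨*⟩ diff u′ ⟨+⟩ _ ⟨*⟩ diff v ⟨+⟩ _ ⟨*⟩ diff w ⟨+⟩ _ ⟨*⟩ diff θB))

        module _ {q : Carrier}
          (y : q ≋ x ⊠ (⟦ + 2 ⟧ ⊠ (c ⊠ g) ⊞ (b ⊞ ⟦ - + 1 ⟧ ⊠ c) ⊠ p)) where

          private
            y′ : q ≋ x ⊠ (⟦ + 2 ⟧ ⊠ (c ⊠ g)
              ⊞ (b ⊞ ⟦ - + 1 ⟧ ⊠ c) ⊠ (b ⊞ ⟦ - + 3 ⟧ ⊠ c ⊞ ⟦ + 2 ⟧ ⊞ x))
            y′ = R.trans y (*-cong R.refl (+-cong R.refl (*-cong R.refl p-def)))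

          -- In the difference of `y` and `u` the terms with g on the right cancel and q - g =
          -- -2xc(p + τ) remains, where p + τ = b - 2c + 1. Then 2xbc = b - 1 and xc² = c - 1
          -- finish.
          Q-closed : q ⊞ b ⊞ ⟦ + 2 ⟧ ⊠ (x ⊠ c) ⊞ ⟦ + 3 ⟧ ≋ g ⊞ ⟦ + 4 ⟧ ⊠ c
          Q-closed = undiff (R.trans
            (solve 5 (λ x b c g q →
              let p = b :+ con (- + 3) :* c :+ con (+ 2) :+ x
                  τ = c :+ con (- + 1) :+ con (- + 1) :* x in
              (q :+ b :+ con (+ 2) :* (x :* c) :+ con (+ 3)) :+ :- (g :+ con (+ 4) :* c)
              := con (+ 1) :* (q :+ :- (x :* (con (+ 2) :* (c :* g)
                                              :+ (b :+ con (- + 1) :* c) :* p)))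
                 :+ con (- + 1) :* (g :+ :- (x :* (con (+ 2) :* (c :* g) :+ b :* p
                                                   :+ (c :* (p :+ τ) :+ c :* τ))))
                 :+ con (+ 1) :* ((con (+ 1) :+ con (- + 2) :* (x :* c)) :* b :+ :- con (+ 1))
                 :+ con (- + 4) :* (c :+ :- (con (+ 1) :+ x :* (c :* c))))
              R.refl x b c g q)
            (_ ⟨*⟩ diff y′ ⟨+⟩ _ ⟨*⟩ diff u′ ⟨+⟩ _ ⟨*⟩ diff v ⟨+⟩ _ ⟨*⟩ diff w))

-- From the recurrences to generating functions and their coefficients.

series : (ℕ → ℕ) → Series
series a n = + a n

splitSum-* : ∀ a b n → + splitSum (λ l r → a l ℕ.* b r) n ≡ (series a ⊛ series b) n
splitSum-* a b zero    = ℤP.pos-* (a 0) (b 0)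
splitSum-* a b (suc n) = cong₂ _+_ (ℤP.pos-* (a 0) (b (suc n))) (splitSum-* (a ∘ suc) b n)

-- The hypotheses `g-suc` and `q-suc` are one recurrence at two weights: `φ (suc r)` is `suc r` for
-- `id` and `r` for `pred`, while `φ 1` is 1 and 0.
module Enumeration (c g q : ℕ → ℕ)
  (c-zero : c 0 ≡ 1)
  (c-suc : ∀ n → c (suc n) ≡ splitSum (λ l r → c l ℕ.* c r) n)
  (g-zero : g 0 ≡ 0)
  (g-suc : ∀ n → g (suc n) ≡ splitSum (λ l r → g l ℕ.* c r ℕ.+ c l ℕ.* g r
     ℕ.+ c l ℕ.* c r ℕ.* (suc r ℕ.* (l ∸ 2) ℕ.+ 1 ℕ.* (ι l ℕ.+ (r ∸ 1)))) n)
  (q-zero : q 0 ≡ 0)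
  (q-suc : ∀ n → q (suc n) ≡ splitSum (λ l r → g l ℕ.* c r ℕ.+ c l ℕ.* g r
     ℕ.+ c l ℕ.* c r ℕ.* (r ℕ.* (l ∸ 2) ℕ.+ 0 ℕ.* (ι l ℕ.+ (r ∸ 1)))) n)
  where

  b : ℕ → ℕ
  b n = suc n ℕ.* c n

  private
    module E = Elimination seriesRing κ-morphism

    Cₛ Bₛ Pₛ Tₛ Sₛ : Series
    Cₛ = series c
    Bₛ = series b
    Pₛ n = + ((n ∸ 2) ℕ.* c n)
    Tₛ n = + (ι n ℕ.* c n)
    Sₛ = κ (+ 1) ⊕ κ (- + 2) ⊛ (X ⊛ Cₛ)

    κX : ∀ k f n → (κ k ⊛ (X ⊛ f)) (suc n) ≡ k * f n
    κX k f n = trans (κ-⊛ k (X ⊛ f) (suc n)) (cong (k *_) (X-⊛ f n))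

    c-one : c 1 ≡ 1
    c-one = trans (c-suc 0) (cong₂ ℕ._*_ c-zero c-zero)

    C-eq : Cₛ ≈ κ (+ 1) ⊕ X ⊛ (Cₛ ⊛ Cₛ)
    C-eq zero    = cong +_ c-zero
    C-eq (suc n) = begin
      + c (suc n)                          ≡⟨ cong +_ (c-suc n) ⟩
      + splitSum (λ l r → c l ℕ.* c r) n   ≡⟨ splitSum-* c c n ⟩
      (Cₛ ⊛ Cₛ) n                            ≡⟨ X-⊛ (Cₛ ⊛ Cₛ) n ⟨
      (X ⊛ (Cₛ ⊛ Cₛ)) (suc n)                ≡⟨ ℤP.+-identityˡ _ ⟨
      + 0 + (X ⊛ (Cₛ ⊛ Cₛ)) (suc n)          ∎
      where open ≡-Reasoning

    -- In xC the number `c n` sits at index n + 1, so θ multiplies it by n + 1 and produces `b n`;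
    -- that is, θ(xC) = xB.
    θS : θ Sₛ ≈ κ (- + 2) ⊛ (X ⊛ Bₛ)
    θS zero    = refl
    θS (suc n) = begin
      + suc n * (+ 0 + (κ (- + 2) ⊛ (X ⊛ Cₛ)) (suc n))
        ≡⟨ cong (λ t → + suc n * (+ 0 + t)) (κX (- + 2) Cₛ n) ⟩
      + suc n * (+ 0 + - + 2 * Cₛ n)
        ≡⟨ lem (+ suc n) (Cₛ n) ⟩
      - + 2 * (+ suc n * Cₛ n)
        ≡⟨ cong (λ t → - + 2 * t) (ℤP.pos-* (suc n) (c n)) ⟨
      - + 2 * Bₛ n
        ≡⟨ κX (- + 2) Bₛ n ⟨
      (κ (- + 2) ⊛ (X ⊛ Bₛ)) (suc n) ∎
      where
      open ≡-Reasoning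
      lem : ∀ m a → m * (+ 0 + - + 2 * a) ≡ - + 2 * (m * a)
      lem = solve-∀

    -- Comparing θ (Sₛ ⊛ Sₛ) with θ (1 − 4X).
    SB : Sₛ ⊛ Bₛ ≈ κ (+ 1)
    SB n = ℤP.*-cancelˡ-≡ (- + 4) _ _ (begin
      - + 4 * (Sₛ ⊛ Bₛ) n                        ≡⟨ κX (- + 4) (Sₛ ⊛ Bₛ) n ⟨
      (κ (- + 4) ⊛ (X ⊛ (Sₛ ⊛ Bₛ))) (suc n)      ≡⟨ E.square-derivative {X} {Bₛ} {Sₛ} {θ Sₛ} θS (suc n) ⟨
      (θ Sₛ ⊛ Sₛ ⊕ Sₛ ⊛ θ Sₛ) (suc n)              ≡⟨ θ-⊛ Sₛ Sₛ (suc n) ⟨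
      + suc n * (Sₛ ⊛ Sₛ) (suc n)                ≡⟨ cong (λ t → + suc n * t) (E.S² {X} {Cₛ} C-eq (suc n)) ⟩
      + suc n * (+ 0 + (κ (- + 4) ⊛ X) (suc n))
        ≡⟨ cong (λ t → + suc n * (+ 0 + t)) (κ-⊛ (- + 4) X (suc n)) ⟩
      + suc n * (+ 0 + - + 4 * κ (+ 1) n)      ≡⟨ θX n ⟩
      - + 4 * κ (+ 1) n                        ∎)
      where
      open ≡-Reasoning
      θX : ∀ n → + suc n * (+ 0 + - + 4 * κ (+ 1) n) ≡ - + 4 * κ (+ 1) n
      θX zero    = refl
      θX (suc n) = ℤP.*-zeroʳ (+ suc (suc n))

    SθB : Sₛ ⊛ θ Bₛ ≈ κ (+ 2) ⊛ (X ⊛ (Bₛ ⊛ Bₛ))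
    SθB = E.inverse-derivative {X} {Bₛ} {Sₛ} {θ Sₛ} {θ Bₛ} θS λ n → begin
      (θ Sₛ ⊛ Bₛ ⊕ Sₛ ⊛ θ Bₛ) n   ≡⟨ θ-⊛ Sₛ Bₛ n ⟨
      + n * (Sₛ ⊛ Bₛ) n         ≡⟨ cong (λ t → + n * t) (SB n) ⟩
      + n * κ (+ 1) n         ≡⟨ θ1 n ⟩
      κ (+ 0) n               ∎
      where
      open ≡-Reasoning
      θ1 : ∀ n → + n * κ (+ 1) n ≡ κ (+ 0) n
      θ1 zero    = refl
      θ1 (suc n) = ℤP.*-zeroʳ (+ suc n)

    -- The factor n - 2 is (n + 1) - 3; the summands 2 and x undo the values -2 and -1 at n = 0 and
    -- n = 1, where `n ∸ 2` truncates.
    P-eq : Pₛ ≈ Bₛ ⊕ κ (- + 3) ⊛ Cₛ ⊕ κ (+ 2) ⊕ X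
    P-eq zero rewrite c-zero = refl
    P-eq (suc zero) rewrite c-one = refl
    P-eq (suc (suc n)) = begin
      + (n ℕ.* c m)
        ≡⟨ ℤP.pos-* n (c m) ⟩
      + n * + c m
        ≡⟨ lem (+ n) (+ c m) ⟩
      (+ 3 + + n) * + c m + - + 3 * + c m + + 0 + + 0
        ≡⟨ cong₂ (λ s t → s + t + + 0 + + 0) (ℤP.pos-* (suc m) (c m)) (κ-⊛ (- + 3) Cₛ m) ⟨
      (Bₛ ⊕ κ (- + 3) ⊛ Cₛ ⊕ κ (+ 2) ⊕ X) m ∎
      where
      open ≡-Reasoning
      m = suc (suc n)
      lem : ∀ n a → n * a ≡ (+ 3 + n) * a + - + 3 * a + + 0 + + 0
      lem = solve-∀

    T-eq : Tₛ ≈ Cₛ ⊕ κ (- + 1) ⊕ κ (- + 1) ⊛ X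
    T-eq zero rewrite c-zero = refl
    T-eq (suc zero) rewrite c-one = refl
    T-eq (suc (suc n)) = begin
      + (1 ℕ.* c m)              ≡⟨ cong +_ (ℕP.*-identityˡ (c m)) ⟩
      + c m                      ≡⟨ lem (+ c m) ⟩
      + c m + + 0 + - + 1 * X m  ≡⟨ cong (λ t → + c m + + 0 + t) (κ-⊛ (- + 1) X m) ⟨
      (Cₛ ⊕ κ (- + 1) ⊕ κ (- + 1) ⊛ X) m ∎
      where
      open ≡-Reasoning
      m = suc (suc n)
      lem : ∀ a → a ≡ a + + 0 + - + 1 * + 0
      lem = solve-∀

    X-eq : ∀ {a} {f : Series} → a 0 ≡ 0 → (∀ n → + a (suc n) ≡ f n) → series a ≈ X ⊛ f
    X-eq p q zero    = cong +_ p
    X-eq {f = f} p q (suc n) = trans (q n) (sym (X-⊛ f n))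

    κ2-⊛ : ∀ f n → (κ (+ 2) ⊛ f) n ≡ f n + f n
    κ2-⊛ f n = trans (κ-⊛ (+ 2) f n) (lem (f n))
      where
      lem : ∀ a → + 2 * a ≡ a + a
      lem = solve-∀

    module _ where
      open ≡-Reasoning

      -- The factor `suc r` combines with `c r` to `b r`. Writing `r ∸ 1` as `(r ∸ 2) + ι r` lets
      -- the series `Pₛ` and `Tₛ` serve for both blocks.
      G-eq : series g ≈ X ⊛ (κ (+ 2) ⊛ (Cₛ ⊛ series g) ⊕ Bₛ ⊛ Pₛ ⊕ (Cₛ ⊛ (Pₛ ⊕ Tₛ) ⊕ Cₛ ⊛ Tₛ))
      G-eq = X-eq {g} g-zero λ n → begin
        + g (suc n)
          ≡⟨ cong +_ (trans (g-suc n) (trans (splitSum-cong expand n) (sums n))) ⟩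
        + (splitSum (λ l r → g l ℕ.* c r) n ℕ.+ splitSum (λ l r → c l ℕ.* g r) n
           ℕ.+ splitSum (λ l r → ((l ∸ 2) ℕ.* c l) ℕ.* b r) n
           ℕ.+ (splitSum (λ l r → c l ℕ.* ((r ∸ 2) ℕ.* c r ℕ.+ ι r ℕ.* c r)) n
                ℕ.+ splitSum (λ l r → (ι l ℕ.* c l) ℕ.* c r) n))
          ≡⟨ cong₂ _+_ (cong₂ _+_ (cong₂ _+_ (trans (splitSum-* g c n) (⊛-comm (series g) Cₛ n)) (splitSum-* c g n))
               (trans (splitSum-* (λ l → (l ∸ 2) ℕ.* c l) b n) (⊛-comm Pₛ Bₛ n)))
               (cong₂ _+_ (splitSum-* c (λ r → (r ∸ 2) ℕ.* c r ℕ.+ ι r ℕ.* c r) n)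
                 (trans (splitSum-* (λ l → ι l ℕ.* c l) c n) (⊛-comm Tₛ Cₛ n))) ⟩
        (Cₛ ⊛ series g) n + (Cₛ ⊛ series g) n + (Bₛ ⊛ Pₛ) n + ((Cₛ ⊛ (Pₛ ⊕ Tₛ)) n + (Cₛ ⊛ Tₛ) n)
          ≡⟨ cong (λ t → t + (Bₛ ⊛ Pₛ) n + ((Cₛ ⊛ (Pₛ ⊕ Tₛ)) n + (Cₛ ⊛ Tₛ) n)) (κ2-⊛ (Cₛ ⊛ series g) n) ⟨
        (κ (+ 2) ⊛ (Cₛ ⊛ series g) ⊕ Bₛ ⊛ Pₛ ⊕ (Cₛ ⊛ (Pₛ ⊕ Tₛ) ⊕ Cₛ ⊛ Tₛ)) n ∎
        where
        pred-split : ∀ r → r ∸ 1 ≡ (r ∸ 2) ℕ.+ ι r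
        pred-split zero          = refl
        pred-split (suc zero)    = refl
        pred-split (suc (suc r)) = sym (ℕP.+-comm r 1)
        lem : ∀ u v x y r l2 i r2 j →
          u ℕ.+ v ℕ.+ x ℕ.* y ℕ.* (r ℕ.* l2 ℕ.+ 1 ℕ.* (i ℕ.+ (r2 ℕ.+ j)))
          ≡ u ℕ.+ v ℕ.+ (l2 ℕ.* x) ℕ.* (r ℕ.* y)
            ℕ.+ (x ℕ.* (r2 ℕ.* y ℕ.+ j ℕ.* y) ℕ.+ (i ℕ.* x) ℕ.* y)
        lem = ℕRing.solve-∀
        expand : ∀ l r → g l ℕ.* c r ℕ.+ c l ℕ.* g r
            ℕ.+ c l ℕ.* c r ℕ.* (suc r ℕ.* (l ∸ 2) ℕ.+ 1 ℕ.* (ι l ℕ.+ (r ∸ 1)))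
          ≡ g l ℕ.* c r ℕ.+ c l ℕ.* g r ℕ.+ ((l ∸ 2) ℕ.* c l) ℕ.* b r
            ℕ.+ (c l ℕ.* ((r ∸ 2) ℕ.* c r ℕ.+ ι r ℕ.* c r) ℕ.+ (ι l ℕ.* c l) ℕ.* c r)
        expand l r rewrite pred-split r =
          lem (g l ℕ.* c r) (c l ℕ.* g r) (c l) (c r) (suc r) (l ∸ 2) (ι l) (r ∸ 2) (ι r)
        sums : ∀ n → _ ≡ _
        sums n = trans (splitSum-+ _ _ n) (cong₂ ℕ._+_
          (trans (splitSum-+ _ _ n) (cong₂ ℕ._+_ (splitSum-+ _ _ n) refl)) (splitSum-+ _ _ n))

      -- The weight `pred` kills the boundary terms, and its factor `r` in place of `suc r` replaces
      -- B by B - C.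
      Q-eq : series q ≈ X ⊛ (κ (+ 2) ⊛ (Cₛ ⊛ series g) ⊕ (Bₛ ⊕ κ (- + 1) ⊛ Cₛ) ⊛ Pₛ)
      Q-eq = X-eq {q} q-zero λ n → begin
        + q (suc n)
          ≡⟨ cong +_ (trans (q-suc n) (trans (splitSum-cong expand n) (sums n))) ⟩
        + (splitSum (λ l r → g l ℕ.* c r) n ℕ.+ splitSum (λ l r → c l ℕ.* g r) n
           ℕ.+ splitSum (λ l r → ((l ∸ 2) ℕ.* c l) ℕ.* (r ℕ.* c r)) n)
          ≡⟨ cong₂ _+_ (cong₂ _+_ (trans (splitSum-* g c n) (⊛-comm (series g) Cₛ n)) (splitSum-* c g n))
               (trans (splitSum-* (λ l → (l ∸ 2) ℕ.* c l) (λ r → r ℕ.* c r) n)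
                 (trans (⊛-comm Pₛ (series λ r → r ℕ.* c r) n) (⊛-cong B-C (λ _ → refl) n))) ⟩
        (Cₛ ⊛ series g) n + (Cₛ ⊛ series g) n + ((Bₛ ⊕ κ (- + 1) ⊛ Cₛ) ⊛ Pₛ) n
          ≡⟨ cong (λ t → t + ((Bₛ ⊕ κ (- + 1) ⊛ Cₛ) ⊛ Pₛ) n) (κ2-⊛ (Cₛ ⊛ series g) n) ⟨
        (κ (+ 2) ⊛ (Cₛ ⊛ series g) ⊕ (Bₛ ⊕ κ (- + 1) ⊛ Cₛ) ⊛ Pₛ) n ∎
        where
        lem : ∀ u v x y r l2 i →
          u ℕ.+ v ℕ.+ x ℕ.* y ℕ.* (r ℕ.* l2 ℕ.+ 0 ℕ.* i)
          ≡ u ℕ.+ v ℕ.+ (l2 ℕ.* x) ℕ.* (r ℕ.* y)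
        lem = ℕRing.solve-∀
        expand : ∀ l r → g l ℕ.* c r ℕ.+ c l ℕ.* g r
            ℕ.+ c l ℕ.* c r ℕ.* (r ℕ.* (l ∸ 2) ℕ.+ 0 ℕ.* (ι l ℕ.+ (r ∸ 1)))
          ≡ g l ℕ.* c r ℕ.+ c l ℕ.* g r ℕ.+ ((l ∸ 2) ℕ.* c l) ℕ.* (r ℕ.* c r)
        expand l r = lem (g l ℕ.* c r) (c l ℕ.* g r) (c l) (c r) r (l ∸ 2) (ι l ℕ.+ (r ∸ 1))
        sums : ∀ n → _ ≡ _
        sums n = trans (splitSum-+ _ _ n) (cong₂ ℕ._+_ (splitSum-+ _ _ n) refl)
        B-C : series (λ r → r ℕ.* c r) ≈ Bₛ ⊕ κ (- + 1) ⊛ Cₛ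
        B-C r = begin
          + (r ℕ.* c r)                         ≡⟨ lem′ (+ c r) (+ (r ℕ.* c r)) ⟩
          + c r + + (r ℕ.* c r) + - + 1 * + c r ≡⟨ cong (λ t → + b r + t) (κ-⊛ (- + 1) Cₛ r) ⟨
          (Bₛ ⊕ κ (- + 1) ⊛ Cₛ) r                 ∎
          where
          lem′ : ∀ a s → s ≡ a + s + - + 1 * a
          lem′ = solve-∀

  -- Extraction of coefficients and the closed form.

  B²-coeff : ∀ n → (Bₛ ⊛ Bₛ) n ≡ + (4 ℕ.^ n)
  B²-coeff zero    rewrite c-zero = refl
  B²-coeff (suc n) = begin
    (Bₛ ⊛ Bₛ) (suc n)                                ≡⟨ E.B² {X} {Bₛ} {Cₛ} C-eq SB (suc n) ⟩
    + 0 + (κ (+ 4) ⊛ (X ⊛ (Bₛ ⊛ Bₛ))) (suc n)        ≡⟨ ℤP.+-identityˡ _ ⟩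
    (κ (+ 4) ⊛ (X ⊛ (Bₛ ⊛ Bₛ))) (suc n)              ≡⟨ κX (+ 4) (Bₛ ⊛ Bₛ) n ⟩
    + 4 * (Bₛ ⊛ Bₛ) n                                ≡⟨ cong (λ t → + 4 * t) (B²-coeff n) ⟩
    + 4 * + (4 ℕ.^ n)                              ≡⟨ ℤP.pos-* 4 (4 ℕ.^ n) ⟨
    + (4 ℕ.^ suc n)                                ∎
    where open ≡-Reasoning

  BC-coeff : ∀ n → + 2 * (Bₛ ⊛ Cₛ) n ≡ + b (suc n)
  BC-coeff n = begin
    + 2 * (Bₛ ⊛ Cₛ) n                            ≡⟨ κX (+ 2) (Bₛ ⊛ Cₛ) n ⟨
    (κ (+ 2) ⊛ (X ⊛ (Bₛ ⊛ Cₛ))) (suc n)          ≡⟨ ℤP.+-identityˡ _ ⟨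
    + 0 + (κ (+ 2) ⊛ (X ⊛ (Bₛ ⊛ Cₛ))) (suc n)    ≡⟨ E.BC {X} {Bₛ} {Cₛ} C-eq SB (suc n) ⟨
    + b (suc n)                                ∎
    where open ≡-Reasoning

  b-recurrence : ∀ n → + suc n * + b (suc n) ≡ (+ 4 * + n + + 2) * + b n
  b-recurrence n = begin
    θ Bₛ (suc n)
      ≡⟨ E.θB-recurrence {X} {Bₛ} {Cₛ} C-eq SB {θ Bₛ} SθB (suc n) ⟩
    (κ (+ 4) ⊛ (X ⊛ θ Bₛ)) (suc n) + (κ (+ 2) ⊛ (X ⊛ Bₛ)) (suc n)
      ≡⟨ cong₂ _+_ (κX (+ 4) (θ Bₛ) n) (κX (+ 2) Bₛ n) ⟩
    + 4 * (+ n * Bₛ n) + + 2 * Bₛ n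
      ≡⟨ lem (+ n) (Bₛ n) ⟩
    (+ 4 * + n + + 2) * Bₛ n ∎
    where
    open ≡-Reasoning
    lem : ∀ n a → + 4 * (n * a) + + 2 * a ≡ (+ 4 * n + + 2) * a
    lem = solve-∀

  -- From index 2 on the isolated term x has coefficient 0, and x²B² can be read off as `4 ^ m`.
  g-closed : ∀ m → let n = suc (suc m) in
    + 2 * + g n + + 2 * + (4 ℕ.^ n) + + b (suc n) + + b (suc m)
      ≡ + n * + b n + + 4 * + b n + + 4 * + (4 ℕ.^ suc m) + + 2 * + (4 ℕ.^ m)
  g-closed m = begin
    + 2 * + g n + + 2 * + (4 ℕ.^ n) + + b (suc n) + + b (suc m)
      ≡⟨ cong₂ _+_ (cong₂ _+_ (cong₂ _+_ (κ-⊛ (+ 2) (series g) n)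
           (trans (κ-⊛ (+ 2) (Bₛ ⊛ Bₛ) n) (cong (λ t → + 2 * t) (B²-coeff n))))
           (trans (κ-⊛ (+ 2) (Bₛ ⊛ Cₛ) n) (BC-coeff n))) (X-⊛ Bₛ (suc m)) ⟨
    (κ (+ 2) ⊛ series g ⊕ κ (+ 2) ⊛ (Bₛ ⊛ Bₛ) ⊕ κ (+ 2) ⊛ (Bₛ ⊛ Cₛ) ⊕ X ⊛ Bₛ) n
      ≡⟨ E.G-closed {X} {Bₛ} {Cₛ} C-eq SB {θ Bₛ} SθB {Pₛ} {Tₛ} {series g} P-eq T-eq G-eq n ⟩
    (θ Bₛ ⊕ κ (+ 4) ⊛ Bₛ ⊕ κ (+ 4) ⊛ (X ⊛ (Bₛ ⊛ Bₛ)) ⊕ κ (+ 2) ⊛ (X ⊛ (X ⊛ (Bₛ ⊛ Bₛ))) ⊕ X) n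
      ≡⟨ trans (ℤP.+-identityʳ _) (cong₂ _+_ (cong₂ _+_ (cong (λ t → + n * + b n + t) (κ-⊛ (+ 4) Bₛ n))
           (trans (κX (+ 4) (Bₛ ⊛ Bₛ) (suc m)) (cong (λ t → + 4 * t) (B²-coeff (suc m)))))
           (trans (κX (+ 2) (X ⊛ (Bₛ ⊛ Bₛ)) (suc m)) (cong (λ t → + 2 * t)
             (trans (X-⊛ (Bₛ ⊛ Bₛ) m) (B²-coeff m))))) ⟩
    + n * + b n + + 4 * + b n + + 4 * + (4 ℕ.^ suc m) + + 2 * + (4 ℕ.^ m) ∎
    where
    open ≡-Reasoning
    n = suc (suc m)

  q-closed : ∀ m → + q (suc m) + + b (suc m) + + 2 * + c m ≡ + g (suc m) + + 4 * + c (suc m)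
  q-closed m = begin
    + q n + + b n + + 2 * + c m
      ≡⟨ trans (ℤP.+-identityʳ _) (cong (λ t → + q n + + b n + t) (κX (+ 2) Cₛ m)) ⟨
    (series q ⊕ Bₛ ⊕ κ (+ 2) ⊛ (X ⊛ Cₛ) ⊕ κ (+ 3)) n
      ≡⟨ E.Q-closed {X} {Bₛ} {Cₛ} C-eq SB {θ Bₛ} SθB {Pₛ} {Tₛ} {series g} P-eq T-eq G-eq {series q} Q-eq n ⟩
    (series g ⊕ κ (+ 4) ⊛ Cₛ) n
      ≡⟨ cong (λ t → + g n + t) (κ-⊛ (+ 4) Cₛ n) ⟩
    + g n + + 4 * + c n ∎
    where
    open ≡-Reasoning
    n = suc m

  -- Since (4n + 2)(n + 1) = (2n + 2)(2n + 1), the recurrence supplies exactly the two factors that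
  -- lead from (2n)! to (2n + 2)!.
  b-factorial : ∀ n → b n ℕ.* (n ! ℕ.* n !) ≡ (2 ℕ.* n) !
  b-factorial zero rewrite c-zero = refl
  b-factorial (suc n) = begin
    b (suc n) ℕ.* (suc n ! ℕ.* suc n !)
      ≡⟨ lem₁ (b (suc n)) n (n !) ⟩
    (suc n ℕ.* b (suc n)) ℕ.* (suc n ℕ.* (n ! ℕ.* n !))
      ≡⟨ cong (ℕ._* (suc n ℕ.* (n ! ℕ.* n !))) (ℤP.+-injective recℕ) ⟩
    ((4 ℕ.* n ℕ.+ 2) ℕ.* b n) ℕ.* (suc n ℕ.* (n ! ℕ.* n !))
      ≡⟨ lem₂ (b n) n (n ! ℕ.* n !) ⟩
    suc (suc (2 ℕ.* n)) ℕ.* (suc (2 ℕ.* n) ℕ.* (b n ℕ.* (n ! ℕ.* n !)))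
      ≡⟨ cong (λ t → suc (suc (2 ℕ.* n)) ℕ.* (suc (2 ℕ.* n) ℕ.* t)) (b-factorial n) ⟩
    suc (suc (2 ℕ.* n)) !
      ≡⟨ cong _! (lem₃ n) ⟩
    (2 ℕ.* suc n) ! ∎
    where
    open ≡-Reasoning
    lem₁ : ∀ β n f → β ℕ.* ((suc n ℕ.* f) ℕ.* (suc n ℕ.* f)) ≡ (suc n ℕ.* β) ℕ.* (suc n ℕ.* (f ℕ.* f))
    lem₁ = ℕRing.solve-∀
    lem₂ : ∀ β n f → ((4 ℕ.* n ℕ.+ 2) ℕ.* β) ℕ.* (suc n ℕ.* f)
      ≡ suc (suc (2 ℕ.* n)) ℕ.* (suc (2 ℕ.* n) ℕ.* (β ℕ.* f))
    lem₂ = ℕRing.solve-∀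
    lem₃ : ∀ n → suc (suc (2 ℕ.* n)) ≡ 2 ℕ.* suc n
    lem₃ = ℕRing.solve-∀
    recℕ : + (suc n ℕ.* b (suc n)) ≡ + ((4 ℕ.* n ℕ.+ 2) ℕ.* b n)
    recℕ = trans (ℤP.pos-* (suc n) (b (suc n))) (trans (b-recurrence n)
      (trans (cong (λ t → (t + + 2) * + b n) (sym (ℤP.pos-* 4 n))) (sym (ℤP.pos-* (4 ℕ.* n ℕ.+ 2) (b n)))))

  b≡central : ∀ n → b n ≡ (2 ℕ.* n) C n
  b≡central n = sym (begin
    (2 ℕ.* n) C n
      ≡⟨ nCk≡n!/k![n-k]! (ℕP.m≤m+n n (n ℕ.+ 0)) ⟩
    ((2 ℕ.* n) !) ℕ./ (n ! ℕ.* (2 ℕ.* n ∸ n) !)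
      ≡⟨ /-congʳ {m = (2 ℕ.* n) !} (cong (λ t → n ! ℕ.* t !) (trans (ℕP.m+n∸m≡n n (n ℕ.+ 0)) (ℕP.+-identityʳ n))) ⟩
    ((2 ℕ.* n) !) ℕ./ (n ! ℕ.* n !)
      ≡⟨ /-congˡ {o = n ! ℕ.* n !} (b-factorial n) ⟨
    (b n ℕ.* (n ! ℕ.* n !)) ℕ./ (n ! ℕ.* n !)
      ≡⟨ m*n/n≡m (b n) (n ! ℕ.* n !) ⟩
    b n ∎)
    where
    open ≡-Reasoning
    instance
      d₁ : NonZero (n ! ℕ.* n !)
      d₁ = ℕP.m*n≢0 (n !) (n !) {{n ℕP.!≢0}} {{n ℕP.!≢0}}
      d₂ : NonZero (n ! ℕ.* (2 ℕ.* n ∸ n) !)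
      d₂ = ℕP.m*n≢0 (n !) ((2 ℕ.* n ∸ n) !) {{n ℕP.!≢0}} {{(2 ℕ.* n ∸ n) ℕP.!≢0}}

  c-recurrence : ∀ m → + suc (suc m) * + c (suc m) ≡ (+ 4 * + m + + 2) * + c m
  c-recurrence m = ℤP.*-cancelˡ-≡ (+ suc m) _ _ (begin
    + suc m * (+ suc (suc m) * + c (suc m))    ≡⟨ cong (λ t → + suc m * t) (ℤP.pos-* (suc (suc m)) (c (suc m))) ⟨
    + suc m * + b (suc m)                      ≡⟨ b-recurrence m ⟩
    (+ 4 * + m + + 2) * + b m                  ≡⟨ cong ((+ 4 * + m + + 2) *_) (ℤP.pos-* (suc m) (c m)) ⟩
    (+ 4 * + m + + 2) * (+ suc m * + c m)      ≡⟨ lem (+ 4 * + m + + 2) (+ suc m) (+ c m) ⟩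
    + suc m * ((+ 4 * + m + + 2) * + c m)      ∎)
    where
    open ≡-Reasoning
    lem : ∀ a s d → a * (s * d) ≡ s * (a * d)
    lem = solve-∀

  -- The factor 2n - 1, half of 4M + 2 with M = n - 1, arises from expressing `c (suc m)` through
  -- `c n` by `c-recurrence`. The factor n + 1 comes from passing from `c n` to the central binomial
  -- coefficient.
  closed-form : ∀ m → let n = suc (suc m) in
    (+ 4 * (+ n + + 1) * (+ 2 * + n - + 1)) * (+ q n + + 7 * + (4 ℕ.^ m))
      ≡ (+ 4 * + n * + n * + n - + 7 * + n * + n + + 29 * + n - + 20) * + ((2 ℕ.* n) C n)
  closed-form m = begin
    (+ 4 * (+ n + + 1) * (+ 2 * + n - + 1)) * (+ q n + + 7 * + (4 ℕ.^ m))
      ≡⟨ lem₁ M (+ q n) (+ (4 ℕ.^ m)) ⟩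
    (+ 2 * (+ 2 + M) * (+ 2 * M + + 1)) * (+ 2 * + q n + + 14 * + (4 ℕ.^ m))
      ≡⟨ cong ((+ 2 * (+ 2 + M) * (+ 2 * M + + 1)) *_) doubled ⟩
    (+ 2 * (+ 2 + M) * (+ 2 * M + + 1)) * ((M * M + M + + 8) * + c n - (+ 5 + M) * + c (suc m))
      ≡⟨ lem₂ M (+ c n) (+ c (suc m)) ⟩
    (+ 4 * M + + 2) * (M * M + M + + 8) * ((+ 2 + M) * + c n)
      - (+ 5 + M) * (+ 2 + M) * ((+ 4 * M + + 2) * + c (suc m))
      ≡⟨ cong (λ t → (+ 4 * M + + 2) * (M * M + M + + 8) * ((+ 2 + M) * + c n) - (+ 5 + M) * (+ 2 + M) * t)
           (c-recurrence (suc m)) ⟨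
    (+ 4 * M + + 2) * (M * M + M + + 8) * ((+ 2 + M) * + c n)
      - (+ 5 + M) * (+ 2 + M) * ((+ 2 + M) * + c n)
      ≡⟨ lem₃ M ((+ 2 + M) * + c n) ⟩
    (+ 4 * + n * + n * + n - + 7 * + n * + n + + 29 * + n - + 20) * ((+ 2 + M) * + c n)
      ≡⟨ cong ((+ 4 * + n * + n * + n - + 7 * + n * + n + + 29 * + n - + 20) *_)
           (trans (sym (ℤP.pos-* (suc n) (c n))) (cong +_ (b≡central n))) ⟩
    (+ 4 * + n * + n * + n - + 7 * + n * + n + + 29 * + n - + 20) * + ((2 ℕ.* n) C n) ∎
    where
    open ≡-Reasoning
    n = suc (suc m)
    M = + suc m

    lem₁ : ∀ M q p → (+ 4 * ((+ 1 + M) + + 1) * (+ 2 * (+ 1 + M) - + 1)) * (q + + 7 * p)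
      ≡ (+ 2 * (+ 2 + M) * (+ 2 * M + + 1)) * (+ 2 * q + + 14 * p)
    lem₁ = solve-∀
    lem₂ : ∀ M a d →
      (+ 2 * (+ 2 + M) * (+ 2 * M + + 1)) * ((M * M + M + + 8) * a - (+ 5 + M) * d)
      ≡ (+ 4 * M + + 2) * (M * M + M + + 8) * ((+ 2 + M) * a)
        - (+ 5 + M) * (+ 2 + M) * ((+ 4 * M + + 2) * d)
    lem₂ = solve-∀
    lem₃ : ∀ M b → (+ 4 * M + + 2) * (M * M + M + + 8) * b - (+ 5 + M) * (+ 2 + M) * b
      ≡ (+ 4 * (+ 1 + M) * (+ 1 + M) * (+ 1 + M) - + 7 * (+ 1 + M) * (+ 1 + M)
         + + 29 * (+ 1 + M) - + 20) * b
    lem₃ = solve-∀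

    -- The three series -2B², 4xB² and 2x²B² contribute -32, 16 and 2 times `4 ^ m`, in total -14;
    -- this is the origin of the constant 7. The remaining values of `b` are rewritten in terms of
    -- `c n` and `c (suc m)`.
    doubled : + 2 * + q n + + 14 * + (4 ℕ.^ m)
      ≡ (M * M + M + + 8) * + c n - (+ 5 + M) * + c (suc m)
    doubled = begin
      + 2 * + q n + + 14 * p
        ≡⟨ lem₄ (+ q n) β (+ c (suc m)) p ⟩
      + 2 * (+ q n + β + + 2 * + c (suc m)) - + 2 * β - + 4 * + c (suc m) + + 14 * p
        ≡⟨ cong (λ t → + 2 * t - + 2 * β - + 4 * + c (suc m) + + 14 * p) (q-closed (suc m)) ⟩
      + 2 * (+ g n + + 4 * + c n) - + 2 * β - + 4 * + c (suc m) + + 14 * p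
        ≡⟨ lem₅ (+ g n) (+ c n) β (+ c (suc m)) p (+ b (suc n)) (+ b (suc m)) ⟩
      (+ 2 * + g n + + 2 * (+ 4 * (+ 4 * p)) + + b (suc n) + + b (suc m))
        - + b (suc n) - + b (suc m) + + 8 * + c n - + 2 * β - + 4 * + c (suc m) - + 18 * p
        ≡⟨ cong (λ t → t - + b (suc n) - + b (suc m) + + 8 * + c n - + 2 * β - + 4 * + c (suc m) - + 18 * p)
             (trans (cong (λ t → + 2 * + g n + + 2 * t + + b (suc n) + + b (suc m)) (sym 4^n))
               (trans (g-closed m)
                 (cong (λ t → + n * β + + 4 * β + + 4 * t + + 2 * p) (ℤP.pos-* 4 (4 ℕ.^ m))))) ⟩
      (+ n * β + + 4 * β + + 4 * (+ 4 * p) + + 2 * p)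
        - + b (suc n) - + b (suc m) + + 8 * + c n - + 2 * β - + 4 * + c (suc m) - + 18 * p
        ≡⟨ cong₂ (λ s t → (+ n * β + + 4 * β + + 4 * (+ 4 * p) + + 2 * p)
             - s - t + + 8 * + c n - + 2 * β - + 4 * + c (suc m) - + 18 * p)
             (trans (ℤP.pos-* (suc (suc n)) (c (suc n))) (c-recurrence n))
             (ℤP.pos-* n (c (suc m))) ⟩
      (+ n * β + + 4 * β + + 4 * (+ 4 * p) + + 2 * p)
        - (+ 4 * + n + + 2) * + c n - + n * + c (suc m)
        + + 8 * + c n - + 2 * β - + 4 * + c (suc m) - + 18 * p
        ≡⟨ cong (λ β → (+ n * β + + 4 * β + + 4 * (+ 4 * p) + + 2 * p)
             - (+ 4 * + n + + 2) * + c n - + n * + c (suc m)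
             + + 8 * + c n - + 2 * β - + 4 * + c (suc m) - + 18 * p) (ℤP.pos-* (suc n) (c n)) ⟩
      _ ≡⟨ lem₆ M (+ c n) (+ c (suc m)) p ⟩
      (M * M + M + + 8) * + c n - (+ 5 + M) * + c (suc m) ∎
      where
      p = + (4 ℕ.^ m)
      β = + b n
      4^n : + (4 ℕ.^ n) ≡ + 4 * (+ 4 * p)
      4^n = trans (ℤP.pos-* 4 (4 ℕ.^ suc m)) (cong (+ 4 *_) (ℤP.pos-* 4 (4 ℕ.^ m)))
      lem₄ : ∀ q b d p → + 2 * q + + 14 * p ≡ + 2 * (q + b + + 2 * d) - + 2 * b - + 4 * d + + 14 * p
      lem₄ = solve-∀
      lem₅ : ∀ g a b d p b₊ b₋ → + 2 * (g + + 4 * a) - + 2 * b - + 4 * d + + 14 * p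
        ≡ (+ 2 * g + + 2 * (+ 4 * (+ 4 * p)) + b₊ + b₋)
          - b₊ - b₋ + + 8 * a - + 2 * b - + 4 * d - + 18 * p
      lem₅ = solve-∀
      lem₆ : ∀ M a d p → let N = + 1 + M; β = (+ 1 + N) * a in
        (N * β + + 4 * β + + 4 * (+ 4 * p) + + 2 * p)
        - (+ 4 * N + + 2) * a - N * d + + 8 * a - + 2 * β - + 4 * d - + 18 * p
        ≡ (M * M + M + + 8) * a - (+ 5 + M) * d
      lem₆ = solve-∀

-- Specialisation to the permutations avoiding 213.

open Counting using (catalan; catalan-suc; windowTotal; windowTotal-suc; Q4-windowTotal)

-- The shift law holds by `refl` for both weights: `pred (suc k + m)` and `pred (suc k) + m` each
-- compute to `k + m`. Likewise `pred (suc r)` and `pred 1` compute to the `r` and `0` of `q-suc`.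
open Enumeration catalan (windowTotal id) (windowTotal pred) refl catalan-suc
  refl (windowTotal-suc refl (λ _ _ → refl)) refl (windowTotal-suc refl (λ _ _ → refl))
  using (closed-form)

theorem7p2 : (n : ℕ) → 2 ≤ n →
    (+ 4 * (+ n + + 1) * (+ 2 * + n - + 1)) * (+ Q4 n + + 7 * + (4 ℕ.^ (n ∸ 2)))
    ≡ (+ 4 * + n * + n * + n - + 7 * + n * + n + + 29 * + n - + 20) * + ((2 ℕ.* n) C n)
theorem7p2 (suc (suc m)) (s≤s (s≤s _)) = trans
  (cong (λ t → (+ 4 * (+ n + + 1) * (+ 2 * + n - + 1)) * (+ t + + 7 * + (4 ℕ.^ m))) (Q4-windowTotal n))
  (closed-form m)
  where n = suc (suc m)
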